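{- Let $\mathcal{M}=(V,\mathcal{I})$ be a matroid of rank $k$ with weights $\omega:V\to\mathbb{R}^+$, let $t$ be a positive integer and $\tau$ a positive integer. Consider the following greedy procedure on $\tau\mathcal{M}=(V,\mathcal{I}_\tau)$: start with $V'=\emptyset$; process the elements of $V$ in non-increasing order of $\omega$; for each element $u$, add $u$ to $V'$ if $V'\cup\{u\}\in\mathcal{I}_\tau$, and otherwise ignore it. Then the final set $V'$ is $t$-robust (i) if $\mathcal{M}$ is a partition matroid and $\tau\ge t$; (ii) if $\mathcal{M}$ is a laminar matroid and $\tau\ge 2t$; (iii) if $\mathcal{M}$ is a transversal matroid and $\tau\ge t+k-1$.
   Context: $\tau\mathcal{M}=(V,\mathcal{I}_\tau)$ is the union of $\tau$ copies of $\mathcal{M}$: $S\in\mathcal{I}_\tau$ iff $S$ can be partitioned into $S_1\cup\dots\cup S_\tau$ with each $S_i\in\mathcal{I}$. A set $V'\subseteq V$ is $t$-robust (with respect to $\omega$) if for every base $O$ of $\mathcal{M}$, writing $O\setminus V'=\{u_1,\dots,u_r\}$, there are subsets $U_{u_1},\dots,U_{u_r}\subseteq V'\setminus O$ such that: (i) the $U_{u_i}$ are mutually disjoint and $|U_{u_i}|=t$; (ii) every element of $U_{u_i}$ has weight $\omega$ at least $\omega(u_i)$; (iii) for any choice of $u'_i\in U_{u_i}$ for each $i$, the set $(V'\cap O)\cup\{u'_1,\dots,u'_r\}$ is a base of $\mathcal{M}$. A partition matroid is given by a partition $V_1,\dots,V_r$ of $V$ and bounds $k_i$, with $S$ independent iff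 $|S\cap V_i|\le k_i$ for all $i$. A laminar matroid is given by a laminar family $V_1,\dots,V_r$ of subsets of $V$ (any two members are disjoint or one contains the other) and bounds $k_i$, with $S$ independent iff $|S\cap V_i|\le k_i$ for all $i$. A transversal matroid is given by a family $V_1,\dots,V_k\subseteq V$, with $S=\{u_1,\dots,u_s\}$ independent iff there are distinct indices $\phi(i)$ with $u_i\in V_{\phi(i)}$.
   Formalization: The weights ω are taken to be positive rational numbers instead of positive real numbers; only their order matters for the greedy procedure and for robustness. -}

module Defs where

open import Data.Nat using (ℕ; _≤_)
open import Data.Fin using (Fin; _≟_)
open import Data.Fin.Subset using (Subset; _∈_; _∉_; _∪_; _∩_; _─_; ⁅_⁆; ∣_∣; _⊆_)
open import Data.Vec using (tabulate)
open import Data.List using (List; []; _∷_)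
open import Data.Product using (Σ; ∃; _×_)
open import Data.Sum using (_⊎_)
open import Data.Rational using (ℚ) renaming (_≤_ to _≤ℚ_)
open import Relation.Nullary using (¬_)
open import Relation.Nullary.Decidable using (⌊_⌋)
open import Relation.Binary.PropositionalEquality using (_≡_; _≢_)
open import Function.Bundles using (_⇔_)

-- Ground set V = Fin n; subsets of V are Data.Fin.Subset.Subset n.
-- An independence system is given by its predicate I : Subset n → Set.

private variable n : ℕ

Base : (Subset n → Set) → Subset n → Set
Base {n} I O = I O × (∀ (v : Fin n) → v ∉ O → ¬ I (O ∪ ⁅ v ⁆))

HasRank : (Subset n → Set) → ℕ → Set
HasRank {n} I k = (∃ λ (S : Subset n) → I S × ∣ S ∣ ≡ k) × (∀ S → I S → ∣ S ∣ ≤ k)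

preimage : ∀ {τ} → (Fin n → Fin τ) → Fin τ → Subset n
preimage c i = tabulate (λ v → ⌊ c v ≟ i ⌋)

-- Union of τ copies: S ∈ I_τ iff S splits into S_1 ∪ … ∪ S_τ with each S_i ∈ I
-- (part i = the elements of S coloured i).
UnionIndep : (Subset n → Set) → ℕ → Subset n → Set
UnionIndep {n} I τ S = ∃ λ (c : Fin n → Fin τ) → ∀ (i : Fin τ) → I (S ∩ preimage c i)

PartitionIndep : ∀ {r} → (Fin n → Fin r) → (Fin r → ℕ) → Subset n → Set
PartitionIndep {r = r} b k S = ∀ (i : Fin r) → ∣ S ∩ preimage b i ∣ ≤ k i

Disjoint : Subset n → Subset n → Set
Disjoint {n} A B = ∀ (v : Fin n) → v ∈ A → v ∉ B

Laminar : ∀ {r} → (Fin r → Subset n) → Set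
Laminar L = ∀ i j → Disjoint (L i) (L j) ⊎ (L i ⊆ L j ⊎ L j ⊆ L i)

LaminarIndep : ∀ {r} → (Fin r → Subset n) → (Fin r → ℕ) → Subset n → Set
LaminarIndep {r = r} L k S = ∀ (i : Fin r) → ∣ S ∩ L i ∣ ≤ k i

TransversalIndep : ∀ {m} → (Fin m → Subset n) → Subset n → Set
TransversalIndep {n} {m} A S =
  ∃ λ (φ : Fin n → Fin m) →
    (∀ u v → u ∈ S → v ∈ S → φ u ≡ φ v → u ≡ v) × (∀ u → u ∈ S → u ∈ A (φ u))

data Greedy {n} (P : Subset n → Set) : Subset n → List (Fin n) → Subset n → Set where
  done : ∀ {S} → Greedy P S [] S
  add  : ∀ {S u us T} → P (S ∪ ⁅ u ⁆) → Greedy P (S ∪ ⁅ u ⁆) us T → Greedy P S (u ∷ us) T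
  skip : ∀ {S u us T} → ¬ P (S ∪ ⁅ u ⁆) → Greedy P S us T → Greedy P S (u ∷ us) T

-- t-robustness of V' w.r.t. ω for the matroid with independence predicate I.
-- U u is the set U_u for u ∈ O ∖ V' (values for other u are irrelevant).
Robust : (Subset n → Set) → (Fin n → ℚ) → ℕ → Subset n → Set
Robust {n} I ω t V' =
  ∀ (O : Subset n) → Base I O →
  Σ (Fin n → Subset n) λ U →
    (∀ u → u ∈ O ─ V' → (U u ⊆ V' ─ O) × (∣ U u ∣ ≡ t) × (∀ v → v ∈ U u → ω u ≤ℚ ω v))
    × (∀ u u' → u ∈ O ─ V' → u' ∈ O ─ V' → u ≢ u' → Disjoint (U u) (U u'))
    × (∀ (f : Fin n → Fin n) → (∀ u → u ∈ O ─ V' → f u ∈ U u) →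
         ∀ (C : Subset n) →
         (∀ v → v ∈ C ⇔ ((v ∈ V' ∩ O) ⊎ (∃ λ u → u ∈ O ─ V' × f u ≡ v))) →
         Base I C)

{-# OPTIONS --safe #-}

-- Bases of all three matroids are exactly the independent sets of maximum size, and an exchanged set is at
-- least as large as O, so only its independence matters.
--
-- Transversal: fix colour classes S_j of V' with their matchings. If u was rejected and O matches u to i,
-- then for every colour j the slot (i , j) is held by an element of V' processed before u. These τ elements
-- are disjoint for different u, and at most k - 1 of them lie in O.
--
-- Laminar: enumerating the ground set so that every member of the family is an interval and colouring
-- cyclically shows that τM is laminar with bounds τ kᵢ. Hence a rejected u lies in a member L with
-- |V' ∩ L| = τ k_L, all of whose V'-elements were processed before u. Going up the laminar tree, V' ∖ O is cut
-- into t-blocks so that each member keeps fewer than t elements pending and is met by at most kᵢ blocks or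
-- kept elements of O. Merging two pending sets wastes fewer than 2t elements per block, so with 2t ≤ τ the
-- member L of a rejected u still contains a block for it. For a partition matroid there is nothing to merge,
-- and t ≤ τ is enough.
module Submission where

open import Defs
open import Data.Nat using (ℕ; zero; suc; _+_; _*_; _∸_; _≤_; _<_; z≤n; s≤s; NonZero; >-nonZero)
open import Data.Nat.DivMod using (_%_; _/_; _mod_; m%n<n; m<n⇒m%n≡m; m≡m%n+[m/n]*n; /-monoˡ-≤; m*n/n≡m; +-distrib-/-∣ʳ; m<n*o⇒m/o<n)
open import Data.Nat.Tactic.RingSolver using (solve-∀)
open import Data.Nat.Divisibility using (n∣m*n)
open import Data.Nat.Properties hiding (_≟_)
open import Data.Fin using (Fin; zero; suc; _≟_; toℕ; fromℕ<)
open import Data.Fin.Properties using (any?; toℕ-fromℕ<; toℕ-injective; toℕ<n) renaming (suc-injective to Fin-suc-injective)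
open import Data.Fin.Subset using (Subset; ⊥; ⊤; ⁅_⁆; _∈_; _∉_; _⊆_; _∪_; _∩_; _─_; _-_; ∣_∣; inside; outside)
open import Data.Fin.Subset.Properties
open import Data.Bool using (true)
open import Data.Vec using ([]; _∷_; here; there; tabulate)
open import Data.Vec.Properties using (lookup∘tabulate; lookup⇒[]=; []=⇒lookup)
open import Data.List using (List; []; _∷_; _++_; allFin; drop; filter; length; map; take; zip)
open import Data.List.Properties using (length-++; length-map; length-take; length-drop; map-++)
open import Data.List.Membership.Propositional.Properties using (∈-allFin; ∈-filter⁺; ∈-map⁺; ∈-map⁻; ∈-++⁺ˡ; ∈-++⁺ʳ)
open import Data.List.Membership.Propositional using () renaming (_∈_ to _∈ₗ_)
open import Data.List.Relation.Unary.All as All using (All; []; _∷_)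
import Data.List.Relation.Unary.All.Properties as Allₚ
import Data.List.Relation.Unary.AllPairs.Properties as AllPairsₚ
open import Data.List.Relation.Unary.AllPairs as AllPairs using (AllPairs; []; _∷_)
open import Data.List.Relation.Unary.Any using (here; there)
import Data.List.Sort as Sort
open import Data.List.Relation.Unary.Unique.Propositional using (Unique)
open import Data.List.Relation.Unary.Unique.Propositional.Properties using (allFin⁺)
open import Data.List.Relation.Unary.Linked.Properties using (Linked⇒AllPairs)
open import Data.List.Relation.Binary.Permutation.Propositional using (_↭_; ↭-sym; ↭⇒↭ₛ)
open import Data.List.Relation.Binary.Permutation.Propositional.Properties using (∈-resp-↭)
open import Data.List.Relation.Binary.Permutation.Setoid.Properties using (Unique-resp-↭)
open import Data.List.Relation.Unary.Linked using (Linked)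
open import Data.Rational using (ℚ; 0ℚ) renaming (_≤_ to _≤ℚ_; _<_ to _<ℚ_)
open import Data.Rational.Properties using () renaming (_≤?_ to _≤ℚ?_; ≤-trans to ≤ℚ-trans)
open import Data.Product using (∃; _×_; _,_; proj₁; proj₂)
open import Data.Sum using (_⊎_; inj₁; inj₂; map₂)
open import Function using (_∘_; id)
open import Function.Bundles using (_⇔_; Equivalence)
open import Relation.Nullary using (¬_; Dec; yes; no; contradiction)
open import Relation.Nullary.Decidable using (⌊_⌋; _×-dec_; ¬?)
open import Relation.Binary.PropositionalEquality
import Relation.Binary.Construct.Flip.EqAndOrd as Flip
import Relation.Binary.Construct.On as On

private variable m n : ℕ

-- Decidable subsets of a finite set and their cardinalities

separate : {P : Fin n → Set} → (∀ v → Dec (P v)) → Subset n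
separate P? = tabulate (λ v → ⌊ P? v ⌋)

∈-separate⁺ : {P : Fin n → Set} (P? : ∀ v → Dec (P v)) {v : Fin n} → P v → v ∈ separate P?
∈-separate⁺ P? {v} p = lookup⇒[]= v _ (trans (lookup∘tabulate _ v) (holds (P? v)))
  where
  holds : (d : Dec _) → ⌊ d ⌋ ≡ true
  holds (yes _) = refl
  holds (no ¬p) = contradiction p ¬p

∈-separate⁻ : {P : Fin n → Set} (P? : ∀ v → Dec (P v)) {v : Fin n} → v ∈ separate P? → P v
∈-separate⁻ P? {v} v∈ = holds (P? v) (trans (sym (lookup∘tabulate _ v)) ([]=⇒lookup v∈))
  where
  holds : (d : Dec _) → ⌊ d ⌋ ≡ true → _
  holds (yes p) _ = p

∈-∩ : {v : Fin n} {p q : Subset n} → v ∈ p → v ∈ q → v ∈ p ∩ q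
∈-∩ v∈p v∈q = x∈p∩q⁺ (v∈p , v∈q)

∈-∩ˡ : {v : Fin n} (p q : Subset n) → v ∈ p ∩ q → v ∈ p
∈-∩ˡ p q = proj₁ ∘ x∈p∩q⁻ p q

∈-∩ʳ : {v : Fin n} (p q : Subset n) → v ∈ p ∩ q → v ∈ q
∈-∩ʳ p q = proj₂ ∘ x∈p∩q⁻ p q

∈-─ʳ : {v : Fin n} (p q : Subset n) → v ∈ p ─ q → v ∉ q
∈-─ʳ (_ ∷ p) (inside ∷ q) () here
∈-─ʳ (_ ∷ p) (inside ∷ q) (there v∈) (there v∈q) = ∈-─ʳ p q v∈ v∈q
∈-─ʳ (_ ∷ p) (outside ∷ q) (there v∈) (there v∈q) = ∈-─ʳ p q v∈ v∈q

∩-monoˡ-⊆ : {p q : Subset n} (r : Subset n) → p ⊆ q → p ∩ r ⊆ q ∩ r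
∩-monoˡ-⊆ {p = p} r p⊆q v∈ = ∈-∩ (p⊆q (∈-∩ˡ p r v∈)) (∈-∩ʳ p r v∈)

∣p∣≡∣p∩q∣+∣p─q∣ : (p q : Subset n) → ∣ p ∣ ≡ ∣ p ∩ q ∣ + ∣ p ─ q ∣
∣p∣≡∣p∩q∣+∣p─q∣ [] [] = refl
∣p∣≡∣p∩q∣+∣p─q∣ (inside ∷ p) (inside ∷ q) = cong suc (∣p∣≡∣p∩q∣+∣p─q∣ p q)
∣p∣≡∣p∩q∣+∣p─q∣ (inside ∷ p) (outside ∷ q) =
  trans (cong suc (∣p∣≡∣p∩q∣+∣p─q∣ p q)) (sym (+-suc _ _))
∣p∣≡∣p∩q∣+∣p─q∣ (outside ∷ p) (inside ∷ q) = ∣p∣≡∣p∩q∣+∣p─q∣ p q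
∣p∣≡∣p∩q∣+∣p─q∣ (outside ∷ p) (outside ∷ q) = ∣p∣≡∣p∩q∣+∣p─q∣ p q

cover-card : {p q s : Subset n} → (∀ v → v ∈ s → v ∈ p ⊎ v ∈ q) → ∣ s ∣ ≤ ∣ p ∣ + ∣ q ∣
cover-card {p = p} {q} {s} cover = begin
  ∣ s ∣                   ≡⟨ ∣p∣≡∣p∩q∣+∣p─q∣ s p ⟩
  ∣ s ∩ p ∣ + ∣ s ─ p ∣   ≤⟨ +-mono-≤ (∣p∩q∣≤∣q∣ s p) (p⊆q⇒∣p∣≤∣q∣ rest) ⟩
  ∣ p ∣ + ∣ q ∣           ∎
  where
  open ≤-Reasoning
  rest : s ─ p ⊆ q
  rest {v} v∈ with cover v (p─q⊆p s p v∈)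
  ... | inj₁ v∈p = contradiction v∈p (∈-─ʳ s p v∈)
  ... | inj₂ v∈q = v∈q

packing-card : {p q s : Subset n} → p ⊆ s → q ⊆ s → Disjoint p q → ∣ p ∣ + ∣ q ∣ ≤ ∣ s ∣
packing-card {p = p} {q} {s} p⊆s q⊆s p#q = begin
  ∣ p ∣ + ∣ q ∣           ≤⟨ +-mono-≤ (p⊆q⇒∣p∣≤∣q∣ (λ v∈p → ∈-∩ (p⊆s v∈p) v∈p))
                                      (p⊆q⇒∣p∣≤∣q∣ (λ v∈q → x∈p∧x∉q⇒x∈p─q (q⊆s v∈q) (λ v∈p → p#q _ v∈p v∈q))) ⟩
  ∣ s ∩ p ∣ + ∣ s ─ p ∣   ≡⟨ sym (∣p∣≡∣p∩q∣+∣p─q∣ s p) ⟩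
  ∣ s ∣                   ∎
  where open ≤-Reasoning

injection-card : (p : Subset n) (q : Subset m) (f : Fin n → Fin m) →
  (∀ {u v} → u ∈ p → v ∈ p → f u ≡ f v → u ≡ v) → (∀ {v} → v ∈ p → f v ∈ q) → ∣ p ∣ ≤ ∣ q ∣
injection-card [] q f inj maps = z≤n
injection-card (outside ∷ p) q f inj maps =
  injection-card p q (f ∘ suc)
    (λ u∈ v∈ eq → Fin-suc-injective (inj (there u∈) (there v∈) eq)) (maps ∘ there)
injection-card (inside ∷ p) q f inj maps =
  ≤-<-trans
    (injection-card p (q - f zero) (f ∘ suc)
      (λ u∈ v∈ eq → Fin-suc-injective (inj (there u∈) (there v∈) eq))
      (λ v∈ → x∈p∧x≢y⇒x∈p-y (maps (there v∈)) (λ eq → contradiction (inj (there v∈) here eq) λ ())))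
    (x∈p⇒∣p-x∣<∣p∣ (maps here))

∣p∪⁅v⁆∣≥1+∣p∣ : {p : Subset n} {v : Fin n} → v ∉ p → suc ∣ p ∣ ≤ ∣ p ∪ ⁅ v ⁆ ∣
∣p∪⁅v⁆∣≥1+∣p∣ {p = p} {v} v∉p = begin
  suc ∣ p ∣           ≡⟨ sym (+-comm ∣ p ∣ 1) ⟩
  ∣ p ∣ + 1           ≡⟨ cong (∣ p ∣ +_) (sym (∣⁅x⁆∣≡1 v)) ⟩
  ∣ p ∣ + ∣ ⁅ v ⁆ ∣   ≤⟨ packing-card (p⊆p∪q ⁅ v ⁆) (q⊆p∪q p ⁅ v ⁆)
                           (λ w w∈p w∈ → v∉p (subst (_∈ p) (x∈⁅y⁆⇒x≡y v w∈) w∈p)) ⟩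
  ∣ p ∪ ⁅ v ⁆ ∣       ∎
  where open ≤-Reasoning

⊆∧∣q∣≤∣p∣⇒⊇ : {p q : Subset n} → p ⊆ q → ∣ q ∣ ≤ ∣ p ∣ → q ⊆ p
⊆∧∣q∣≤∣p∣⇒⊇ {p = p} p⊆q ∣q∣≤∣p∣ {v} v∈q with v ∈? p
... | yes v∈p = v∈p
... | no v∉p = contradiction ∣q∣≤∣p∣ (<⇒≱ (p⊂q⇒∣p∣<∣q∣ (p⊆q , v , v∈q , v∉p)))

subset-of-size : (t : ℕ) (p : Subset n) → t ≤ ∣ p ∣ → ∃ λ (q : Subset n) → q ⊆ p × ∣ q ∣ ≡ t
subset-of-size {n} zero p _ = ⊥ , ⊥⊆ , ∣⊥∣≡0 n
subset-of-size (suc t) (inside ∷ p) (s≤s t≤) with subset-of-size t p t≤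
... | q , q⊆p , eq = inside ∷ q , in⊆in q⊆p , cong suc eq
subset-of-size (suc t) (outside ∷ p) t≤ with subset-of-size (suc t) p t≤
... | q , q⊆p , eq = outside ∷ q , out⊆ q⊆p , eq

-- The greedy procedure

greedy-sound : {P : Subset n → Set} {S T : Subset n} {us : List (Fin n)} → P S → Greedy P S us T → P T
greedy-sound p done = p
greedy-sound _ (add p g) = greedy-sound p g
greedy-sound p (skip _ g) = greedy-sound p g

greedy-extends : {P : Subset n → Set} {S T : Subset n} {us : List (Fin n)} → Greedy P S us T → S ⊆ T
greedy-extends done = id
greedy-extends (add {u = u} _ g) = greedy-extends g ∘ p⊆p∪q ⁅ u ⁆
greedy-extends (skip _ g) = greedy-extends g

-- `S` stands for the greedy set at the moment `u` was processed. Recording that its elements weigh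
-- at least as much as `u` is all that later arguments need to know about the order.
Rejected : (Subset n → Set) → (Fin n → ℚ) → Subset n → Fin n → Set
Rejected {n} P ω V' u =
  ∃ λ (S : Subset n) → S ⊆ V' × ¬ P (S ∪ ⁅ u ⁆) × (∀ v → v ∈ S → ω u ≤ℚ ω v)

-- Induction along the run with the invariant that every collected element weighs at least as much
-- as every element still to come; sortedness preserves it when the head is added.
greedy-rejected : {P : Subset n → Set} (ω : Fin n → ℚ) {S T : Subset n} {us : List (Fin n)} →
  Greedy P S us T → AllPairs (λ a b → ω b ≤ℚ ω a) us →
  (∀ v → v ∈ S → All (λ u → ω u ≤ℚ ω v) us) →
  ∀ {u} → u ∈ₗ us → u ∉ T → Rejected P ω T u
greedy-rejected ω (add {S} {w} p g) (w≥ ∷ sorted) S≥ (here refl) u∉T =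
  contradiction (greedy-extends g (q⊆p∪q S ⁅ w ⁆ (x∈⁅x⁆ w))) u∉T
greedy-rejected ω {us = w ∷ us} (add {S} p g) (w≥ ∷ sorted) S≥ (there u∈) u∉T =
  greedy-rejected ω g sorted S∪w≥ u∈ u∉T
  where
  S∪w≥ : ∀ v → v ∈ S ∪ ⁅ w ⁆ → All (λ u → ω u ≤ℚ ω v) us
  S∪w≥ v v∈ with x∈p∪q⁻ S ⁅ w ⁆ v∈
  ... | inj₁ v∈S = All.tail (S≥ v v∈S)
  ... | inj₂ v∈w rewrite x∈⁅y⁆⇒x≡y w v∈w = w≥
greedy-rejected ω (skip {S} ¬p g) _ S≥ (here refl) u∉T =
  S , greedy-extends g , ¬p , λ v v∈S → All.head (S≥ v v∈S)
greedy-rejected ω (skip ¬p g) (_ ∷ sorted) S≥ (there u∈) u∉T =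
  greedy-rejected ω g sorted (λ v v∈S → All.tail (S≥ v v∈S)) u∈ u∉T

-- From replacement sets to robustness

BaseIsLargest : (Subset n → Set) → Set
BaseIsLargest I = ∀ O D → Base I O → I D → ∣ D ∣ ≤ ∣ O ∣

Exchange : Subset n → Subset n → (Fin n → Fin n) → Subset n → Set
Exchange {n} V' O f C = ∀ v → v ∈ C ⇔ ((v ∈ V' ∩ O) ⊎ (∃ λ u → u ∈ O ─ V' × f u ≡ v))

Replacements : (Subset n → Set) → (Fin n → ℚ) → ℕ → Subset n → Subset n → (Fin n → Subset n) → Set
Replacements {n} I ω t V' O U =
  (∀ u → u ∈ O ─ V' → (U u ⊆ V' ─ O) × (∣ U u ∣ ≡ t) × (∀ v → v ∈ U u → ω u ≤ℚ ω v))
  × (∀ u u' → u ∈ O ─ V' → u' ∈ O ─ V' → u ≢ u' → Disjoint (U u) (U u'))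
  × (∀ (f : Fin n → Fin n) → (∀ u → u ∈ O ─ V' → f u ∈ U u) → ∀ C → Exchange V' O f C → I C)

-- Sending kept elements to themselves and each other `u` to `f u` injects `O` into `C`, because the
-- sets `U u` are disjoint and avoid `O`. A proper independent extension of `C` would then be larger
-- than the base `O`.
robust : {I : Subset n → Set} {ω : Fin n → ℚ} {t : ℕ} {V' : Subset n} → BaseIsLargest I →
  (∀ O → Base I O → ∃ (Replacements I ω t V' O)) → Robust I ω t V'
robust {n} {I} {V' = V'} largest repl O base with repl O base
... | U , good , disj , indep = U , good , disj , λ f f∈U C C≈ →
  indep f f∈U C C≈ , λ v v∉C I∪v → <⇒≱ (∣p∪⁅v⁆∣≥1+∣p∣ v∉C)
    (≤-trans (largest O _ base I∪v) (O≤C f f∈U C C≈))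
  where
  O≤C : ∀ f → (∀ u → u ∈ O ─ V' → f u ∈ U u) → ∀ C → Exchange V' O f C → ∣ O ∣ ≤ ∣ C ∣
  O≤C f f∈U C C≈ = injection-card O C g g-inj g∈C
    where
    g : Fin n → Fin n
    g u with u ∈? V'
    ... | yes _ = u
    ... | no _ = f u
    fu∉O : ∀ {u} → u ∈ O → u ∉ V' → f u ∉ O
    fu∉O {u} u∈O u∉V' = ∈-─ʳ V' O (proj₁ (good u u∈) (f∈U u u∈))
      where u∈ = x∈p∧x∉q⇒x∈p─q u∈O u∉V'
    g-inj : ∀ {u v} → u ∈ O → v ∈ O → g u ≡ g v → u ≡ v
    g-inj {u} {v} u∈O v∈O eq with u ∈? V' | v ∈? V'
    ... | yes _ | yes _ = eq
    ... | yes _ | no v∉ = contradiction (subst (_∈ O) eq u∈O) (fu∉O v∈O v∉)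
    ... | no u∉ | yes _ = contradiction (subst (_∈ O) (sym eq) v∈O) (fu∉O u∈O u∉)
    ... | no u∉ | no v∉ with u ≟ v
    ...   | yes u≡v = u≡v
    ...   | no u≢v = contradiction (subst (_∈ U v) (sym eq) (f∈U v v∈)) (disj u v u∈ v∈ u≢v (f u) (f∈U u u∈))
      where
      u∈ = x∈p∧x∉q⇒x∈p─q u∈O u∉
      v∈ = x∈p∧x∉q⇒x∈p─q v∈O v∉
    g∈C : ∀ {u} → u ∈ O → g u ∈ C
    g∈C {u} u∈O with u ∈? V'
    ... | yes u∈V' = Equivalence.from (C≈ u) (inj₁ (∈-∩ u∈V' u∈O))
    ... | no u∉V' = Equivalence.from (C≈ (f u)) (inj₂ (u , x∈p∧x∉q⇒x∈p─q u∈O u∉V' , refl))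

update : {A : Set} → (Fin n → A) → Fin n → A → Fin n → A
update f w a v with v ≟ w
... | yes _ = a
... | no _ = f v

update-here : {A : Set} (f : Fin n → A) (w : Fin n) {a : A} → update f w a w ≡ a
update-here f w with w ≟ w
... | yes _ = refl
... | no w≢w = contradiction refl w≢w

update-elsewhere : {A : Set} (f : Fin n → A) {v w : Fin n} {a : A} → v ≢ w → update f w a v ≡ f v
update-elsewhere f {v} {w} v≢w with v ≟ w
... | yes v≡w = contradiction v≡w v≢w
... | no _ = refl

∈-preimage⁺ : (c : Fin n → Fin m) {v : Fin n} {i : Fin m} → c v ≡ i → v ∈ preimage c i
∈-preimage⁺ c {i = i} = ∈-separate⁺ (λ v → c v ≟ i)

∈-preimage⁻ : (c : Fin n → Fin m) {v : Fin n} (i : Fin m) → v ∈ preimage c i → c v ≡ i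
∈-preimage⁻ c i = ∈-separate⁻ (λ v → c v ≟ i)

-- Transversal matroids

Matching : (Fin m → Subset n) → Subset n → (Fin n → Fin m) → Set
Matching A S φ = (∀ u v → u ∈ S → v ∈ S → φ u ≡ φ v → u ≡ v) × (∀ u → u ∈ S → u ∈ A (φ u))

matching-⊆ : (A : Fin m → Subset n) {S T : Subset n} {φ : Fin n → Fin m} → T ⊆ S → Matching A S φ → Matching A T φ
matching-⊆ A T⊆S (inj , mem) = (λ u v u∈ v∈ → inj u v (T⊆S u∈) (T⊆S v∈)) , λ u u∈ → mem u (T⊆S u∈)

-- `T` need only lie in `S` apart from `w`, so that one lemma covers both matching a new element and
-- moving an already matched one to the free slot `i`.
matching-update : (A : Fin m → Subset n) {S T : Subset n} {φ : Fin n → Fin m} {w : Fin n} {i : Fin m} →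
  Matching A S φ → (∀ v → v ∈ S → φ v ≢ i) → w ∈ A i → (∀ v → v ∈ T → v ≢ w → v ∈ S) →
  Matching A T (update φ w i)
matching-update A {S} {T} {φ} {w} {i} (inj , mem) free w∈A T⊆ = inj′ , mem′
  where
  inj′ : ∀ u v → u ∈ T → v ∈ T → update φ w i u ≡ update φ w i v → u ≡ v
  inj′ u v u∈ v∈ eq with u ≟ w | v ≟ w
  ... | yes u≡w | yes v≡w = trans u≡w (sym v≡w)
  ... | yes u≡w | no v≢w = contradiction (sym eq) (free v (T⊆ v v∈ v≢w))
  ... | no u≢w | yes v≡w = contradiction eq (free u (T⊆ u u∈ u≢w))
  ... | no u≢w | no v≢w = inj u v (T⊆ u u∈ u≢w) (T⊆ v v∈ v≢w) eq
  mem′ : ∀ u → u ∈ T → u ∈ A (update φ w i u)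
  mem′ u u∈ with u ≟ w
  ... | yes refl = w∈A
  ... | no u≢w = mem u (T⊆ u u∈ u≢w)

Free : (S : Subset n) (φ : Fin n → Fin m) (i : Fin m) → Set
Free S φ i = ¬ ∃ λ v → v ∈ S × φ v ≡ i

free? : (S : Subset n) (φ : Fin n → Fin m) (i : Fin m) → Dec (Free S φ i)
free? S φ i = ¬? (any? λ v → v ∈? S ×-dec φ v ≟ i)

-- Pigeonhole: if `φ` used on `O` every slot that `ψ` uses on `D`, sending each `w` to the holder of
-- its slot would inject `D` into the smaller set `O`.
unmatched : (O D : Subset n) (φ ψ : Fin n → Fin m) → (∀ u v → u ∈ D → v ∈ D → ψ u ≡ ψ v → u ≡ v) →
  ∣ O ∣ < ∣ D ∣ → ∃ λ w → w ∈ D × Free O φ (ψ w)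
unmatched {n} O D φ ψ inj O<D with any? (λ w → w ∈? D ×-dec free? O φ (ψ w))
... | yes found = found
... | no none = contradiction (injection-card D O partner partner-inj partner∈O) (<⇒≱ O<D)
  where
  partner : Fin n → Fin n
  partner w with any? (λ v → v ∈? O ×-dec φ v ≟ ψ w)
  ... | yes (v , _) = v
  -- An arbitrary value: for `w` in `D` this case contradicts `none`.
  ... | no _ = w
  partner-spec : ∀ {w} → w ∈ D → partner w ∈ O × φ (partner w) ≡ ψ w
  partner-spec {w} w∈ with any? (λ v → v ∈? O ×-dec φ v ≟ ψ w)
  ... | yes (_ , spec) = spec
  ... | no free = contradiction (w , w∈ , free) none
  partner∈O : ∀ {w} → w ∈ D → partner w ∈ O
  partner∈O = proj₁ ∘ partner-spec
  partner-inj : ∀ {u v} → u ∈ D → v ∈ D → partner u ≡ partner v → u ≡ v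
  partner-inj {u} {v} u∈ v∈ eq =
    inj u v u∈ v∈ (trans (sym (proj₂ (partner-spec u∈))) (trans (cong φ eq) (proj₂ (partner-spec v∈))))

-- The number of these disagreements is the measure for the recursion in `augment`.
disagree? : (O : Subset n) (φ ψ : Fin n → Fin m) (v : Fin n) → Dec (v ∈ O × φ v ≢ ψ v)
disagree? O φ ψ v = v ∈? O ×-dec ¬? (φ v ≟ ψ v)

-- Rematching an element of O to its free ψ-slot increases the agreement of φ with ψ,
-- so eventually a free slot belongs to an element outside O.
augment : (A : Fin m → Subset n) {O D : Subset n} {ψ : Fin n → Fin m} → Matching A D ψ → ∣ O ∣ < ∣ D ∣ →
  (d : ℕ) (φ : Fin n → Fin m) → Matching A O φ → ∣ separate (disagree? O φ ψ) ∣ ≤ d →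
  ∃ λ w → w ∉ O × TransversalIndep A (O ∪ ⁅ w ⁆)
augment {n = n} A {O} {D} {ψ} D-matching O<D d φ O-matching ≤d
  with unmatched O D φ ψ (proj₁ D-matching) O<D
... | w , w∈D , free = go (w ∈? O) d ≤d
  where
  φ′ = update φ w (ψ w)
  free′ : ∀ v → v ∈ O → φ v ≢ ψ w
  free′ v v∈ eq = free (v , v∈ , eq)
  matching′ : ∀ {T} → (∀ v → v ∈ T → v ≢ w → v ∈ O) → Matching A T φ′
  matching′ = matching-update A O-matching free′ (proj₂ D-matching w w∈D)
  back : ∀ v → v ∈ O ∪ ⁅ w ⁆ → v ≢ w → v ∈ O
  back v v∈ v≢w with x∈p∪q⁻ O ⁅ w ⁆ v∈
  ... | inj₁ v∈O = v∈O
  ... | inj₂ v∈w = contradiction (x∈⁅y⁆⇒x≡y w v∈w) v≢w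
  shrink : separate (disagree? O φ′ ψ) ⊆ separate (disagree? O φ ψ)
  shrink {v} v∈ with ∈-separate⁻ (disagree? O φ′ ψ) v∈
  ... | v∈O , ≢ = ∈-separate⁺ (disagree? O φ ψ) (v∈O , λ eq → ≢ (agree eq))
    where
    agree : φ v ≡ ψ v → φ′ v ≡ ψ v
    agree eq with v ≟ w
    ... | yes refl = refl
    ... | no _ = eq
  -- The slot `ψ w` was free, so `w` itself disagreed before the update; it agrees afterwards.
  decrease : w ∈ O → ∣ separate (disagree? O φ′ ψ) ∣ < ∣ separate (disagree? O φ ψ) ∣
  decrease w∈O = p⊂q⇒∣p∣<∣q∣ (shrink , w , ∈-separate⁺ (disagree? O φ ψ) (w∈O , free′ w w∈O)
                   , λ w∈ → proj₂ (∈-separate⁻ (disagree? O φ′ ψ) w∈) (update-here φ w))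
  go : Dec (w ∈ O) → ∀ d → ∣ separate (disagree? O φ ψ) ∣ ≤ d → ∃ λ w → w ∉ O × TransversalIndep A (O ∪ ⁅ w ⁆)
  go (no w∉O) d _ = w , w∉O , φ′ , matching′ back
  go (yes w∈O) zero ≤0 = contradiction (≤-trans (decrease w∈O) ≤0) λ ()
  go (yes w∈O) (suc d) ≤d =
    augment A D-matching O<D d φ′ (matching′ (λ v v∈ _ → v∈)) (≤-pred (≤-trans (decrease w∈O) ≤d))

transversal-largest : (A : Fin m → Subset n) → BaseIsLargest (TransversalIndep A)
transversal-largest A O D ((φ , O-matching) , maximal) (ψ , D-matching) with ∣ D ∣ ≤? ∣ O ∣
... | yes D≤O = D≤O
... | no D≰O with augment A D-matching (≰⇒> D≰O) _ φ O-matching ≤-refl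
...   | w , w∉O , indep = contradiction indep (maximal w w∉O)

-- If colour `j` left the slot `i` free, `u` could be given colour `j` and slot `i`, which would
-- make `S ∪ ⁅ u ⁆` independent in the union.
slot-occupied : {τ : ℕ} (A : Fin m → Subset n) {S : Subset n} (c : Fin n → Fin τ) (φ : Fin τ → Fin n → Fin m) →
  (∀ j → Matching A (S ∩ preimage c j) (φ j)) →
  ∀ {u i} → ¬ UnionIndep (TransversalIndep A) τ (S ∪ ⁅ u ⁆) → u ∈ A i →
  ∀ j → ∃ λ v → v ∈ S × c v ≡ j × φ j v ≡ i
slot-occupied {n = n} A {S} c φ matching {u} {i} rejected u∈A j
  with any? (λ v → v ∈? S ×-dec (c v ≟ j ×-dec φ j v ≟ i))
... | yes found = found
... | no none = contradiction (c′ , colour) rejected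
  where
  c′ = update c u j
  other : ∀ {l v} → v ∈ (S ∪ ⁅ u ⁆) ∩ preimage c′ l → v ≢ u → v ∈ S ∩ preimage c l
  other {l} {v} v∈ v≢u with x∈p∪q⁻ S ⁅ u ⁆ (∈-∩ˡ (S ∪ ⁅ u ⁆) (preimage c′ l) v∈)
  ... | inj₁ v∈S = ∈-∩ v∈S (∈-preimage⁺ c (trans (sym (update-elsewhere c v≢u))
                     (∈-preimage⁻ c′ l (∈-∩ʳ (S ∪ ⁅ u ⁆) (preimage c′ l) v∈))))
  ... | inj₂ v∈u = contradiction (x∈⁅y⁆⇒x≡y u v∈u) v≢u
  free : ∀ v → v ∈ S ∩ preimage c j → φ j v ≢ i
  free v v∈ eq = none (v , ∈-∩ˡ S (preimage c j) v∈ , ∈-preimage⁻ c j (∈-∩ʳ S (preimage c j) v∈) , eq)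
  colour : ∀ l → TransversalIndep A ((S ∪ ⁅ u ⁆) ∩ preimage c′ l)
  colour l with l ≟ j
  ... | yes refl = update (φ j) u i , matching-update A (matching j) free u∈A (λ v v∈ v≢u → other v∈ v≢u)
  ... | no l≢j = φ l , matching-⊆ A (λ {v} v∈ → other v∈ (λ v≡u → l≢j (trans
                   (sym (∈-preimage⁻ c′ l (∈-∩ʳ (S ∪ ⁅ u ⁆) (preimage c′ l) v∈)))
                   (trans (cong c′ v≡u) (update-here c u))))) (matching l)

-- In its application `x` counts the holders of a slot outside `O` and `y` the elements of `O` kept
-- in `V'`.
≤-shift : {t k τ x y : ℕ} → t + k ∸ 1 ≤ τ → τ ≤ x + y → y < k → t ≤ x
≤-shift {t} {k} {τ} {x} {y} t+k∸1≤τ τ≤x+y y<k = +-cancelʳ-≤ k t x (begin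
  t + k               ≤⟨ m≤n+m∸n (t + k) 1 ⟩
  suc (t + k ∸ 1)     ≤⟨ s≤s (≤-trans t+k∸1≤τ τ≤x+y) ⟩
  suc (x + y)         ≡⟨ sym (+-suc x y) ⟩
  x + suc y           ≤⟨ +-monoʳ-≤ x y<k ⟩
  x + k               ∎)
  where open ≤-Reasoning

transversal-robust : (A : Fin m → Subset n) {ω : Fin n → ℚ} {t τ k : ℕ} {V' : Subset n} →
  (∀ S → TransversalIndep A S → ∣ S ∣ ≤ k) → t + k ∸ 1 ≤ τ →
  UnionIndep (TransversalIndep A) τ V' →
  (∀ u → u ∉ V' → Rejected (UnionIndep (TransversalIndep A) τ) ω V' u) →
  Robust (TransversalIndep A) ω t V'
transversal-robust {m} {n} A {ω} {t} {τ} {k} {V'} rank t+k∸1≤τ (c , coloured) rejected =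
  robust (transversal-largest A) replacements
  where
  -- The matchings of all colour classes are read as one map: the colour of `v` selects the matching
  -- that places `v`.
  slot : Fin n → Fin m
  slot v = proj₁ (coloured (c v)) v
  replacements : ∀ O → Base (TransversalIndep A) O → ∃ (Replacements (TransversalIndep A) ω t V' O)
  replacements O ((ψ , ψ-inj , ψ-mem) , maximal) = U , good , disj , indep
    where
    occupant? : ∀ u v → Dec (v ∈ V' × slot v ≡ ψ u × ω u ≤ℚ ω v)
    occupant? u v = v ∈? V' ×-dec (slot v ≟ ψ u ×-dec ω u ≤ℚ? ω v)
    W : Fin n → Subset n
    W u = separate (occupant? u)
    -- Each colour supplies one occupant of the slot `ψ u`, and occupants of different colours are
    -- different elements.
    W-large : ∀ u → u ∈ O ─ V' → τ ≤ ∣ W u ∣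
    W-large u u∈ with rejected u (∈-─ʳ O V' u∈)
    ... | S , S⊆V' , ¬indep , S≥ = ≤-trans (≤-reflexive (sym (∣⊤∣≡n τ)))
        (injection-card ⊤ (W u) (proj₁ ∘ occ) occ-inj occ∈W)
      where
      occ : ∀ j → ∃ λ v → v ∈ S × c v ≡ j × proj₁ (coloured j) v ≡ ψ u
      occ = slot-occupied A c (proj₁ ∘ coloured)
              (λ j → matching-⊆ A (∩-monoˡ-⊆ (preimage c j) S⊆V') (proj₂ (coloured j)))
              ¬indep (ψ-mem u (p─q⊆p O V' u∈))
      occ-inj : ∀ {i j} → i ∈ ⊤ → j ∈ ⊤ → proj₁ (occ i) ≡ proj₁ (occ j) → i ≡ j
      occ-inj {i} {j} _ _ eq with occ i | occ j
      ... | _ , _ , ci , _ | _ , _ , cj , _ = trans (sym ci) (trans (cong c eq) cj)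
      occ∈W : ∀ {j} → j ∈ ⊤ → proj₁ (occ j) ∈ W u
      occ∈W {j} _ with occ j
      ... | v , v∈S , refl , at = ∈-separate⁺ (occupant? u) (S⊆V' v∈S , at , S≥ v v∈S)
    W─O-large : ∀ u → u ∈ O ─ V' → t ≤ ∣ W u ─ O ∣
    W─O-large u u∈ = ≤-shift t+k∸1≤τ τ≤ (≤-trans V'∩O< (rank O (ψ , ψ-inj , ψ-mem)))
      where
      -- Strict because of `u` itself; this is where the `- 1` in the bound on `τ` comes from.
      V'∩O< : ∣ V' ∩ O ∣ < ∣ O ∣
      V'∩O< = p⊂q⇒∣p∣<∣q∣ (p∩q⊆q V' O , u , p─q⊆p O V' u∈ , ∈-─ʳ O V' u∈ ∘ ∈-∩ˡ V' O)
      τ≤ : τ ≤ ∣ W u ─ O ∣ + ∣ V' ∩ O ∣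
      τ≤ = ≤-trans (W-large u u∈) (cover-card cover)
        where
        cover : ∀ v → v ∈ W u → v ∈ W u ─ O ⊎ v ∈ V' ∩ O
        cover v v∈ with v ∈? O
        ... | yes v∈O = inj₂ (∈-∩ (proj₁ (∈-separate⁻ (occupant? u) v∈)) v∈O)
        ... | no v∉O = inj₁ (x∈p∧x∉q⇒x∈p─q v∈ v∉O)
    chosen : ∀ u → Dec (u ∈ O ─ V') → Subset n
    chosen u (yes u∈) = proj₁ (subset-of-size t (W u ─ O) (W─O-large u u∈))
    chosen u (no _) = ⊥
    U : Fin n → Subset n
    U u = chosen u (u ∈? (O ─ V'))
    U-spec : ∀ u → u ∈ O ─ V' → U u ⊆ W u ─ O × ∣ U u ∣ ≡ t
    U-spec u u∈ with u ∈? (O ─ V')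
    ... | yes u∈ = proj₂ (subset-of-size t (W u ─ O) (W─O-large u u∈))
    ... | no u∉ = contradiction u∈ u∉
    U-occupant : ∀ u {v} → u ∈ O ─ V' → v ∈ U u → v ∈ V' × slot v ≡ ψ u × ω u ≤ℚ ω v
    U-occupant u u∈ v∈ = ∈-separate⁻ (occupant? u) (p─q⊆p (W u) O (proj₁ (U-spec u u∈) v∈))
    U-outside : ∀ u {v} → u ∈ O ─ V' → v ∈ U u → v ∉ O
    U-outside u u∈ v∈ = ∈-─ʳ (W u) O (proj₁ (U-spec u u∈) v∈)
    same-slot : ∀ {u u' v v'} → u ∈ O ─ V' → u' ∈ O ─ V' → v ∈ U u → v' ∈ U u' → slot v ≡ slot v' → u ≡ u'
    same-slot {u} {u'} u∈ u'∈ v∈ v'∈ eq = ψ-inj u u' (p─q⊆p O V' u∈) (p─q⊆p O V' u'∈)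
      (trans (sym (proj₁ (proj₂ (U-occupant u u∈ v∈)))) (trans eq (proj₁ (proj₂ (U-occupant u' u'∈ v'∈)))))
    good : ∀ u → u ∈ O ─ V' → (U u ⊆ V' ─ O) × (∣ U u ∣ ≡ t) × (∀ v → v ∈ U u → ω u ≤ℚ ω v)
    good u u∈ = (λ v∈ → x∈p∧x∉q⇒x∈p─q (proj₁ (U-occupant u u∈ v∈)) (U-outside u u∈ v∈))
              , proj₂ (U-spec u u∈)
              , λ v v∈ → proj₂ (proj₂ (U-occupant u u∈ v∈))
    disj : ∀ u u' → u ∈ O ─ V' → u' ∈ O ─ V' → u ≢ u' → Disjoint (U u) (U u')
    disj u u' u∈ u'∈ u≢u' v v∈ v∈' = u≢u' (same-slot u∈ u'∈ v∈ v∈' refl)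
    indep : ∀ f → (∀ u → u ∈ O ─ V' → f u ∈ U u) → ∀ C → Exchange V' O f C → TransversalIndep A C
    indep f f∈U C C≈ = φ , φ-inj , φ-mem
      where
      -- Kept elements stay in their slot of the matching `ψ`. A replacement uses the slot of its
      -- own colour class, which is the slot that `ψ` gave to the element it replaces.
      φ : Fin n → Fin m
      φ v with v ∈? O
      ... | yes _ = ψ v
      ... | no _ = slot v
      kept : ∀ {v} → v ∈ C → v ∈ O → v ∈ V'
      kept {v} v∈C v∈O with Equivalence.to (C≈ v) v∈C
      ... | inj₁ v∈ = ∈-∩ˡ V' O v∈
      ... | inj₂ (u , u∈ , refl) = contradiction v∈O (U-outside u u∈ (f∈U u u∈))
      new : ∀ {v} → v ∈ C → v ∉ O → ∃ λ u → u ∈ O ─ V' × f u ≡ v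
      new {v} v∈C v∉O with Equivalence.to (C≈ v) v∈C
      ... | inj₁ v∈ = contradiction (∈-∩ʳ V' O v∈) v∉O
      ... | inj₂ from = from
      -- A shared slot would identify the kept element `v` with the element replaced by `w`, but
      -- only the former lies in `V'`.
      mixed : ∀ {v w} → v ∈ C → v ∈ O → w ∈ C → w ∉ O → ψ v ≢ slot w
      mixed v∈C v∈O w∈C w∉O eq with new w∈C w∉O
      ... | u , u∈ , refl = ∈-─ʳ O V' u∈ (subst (_∈ V')
              (ψ-inj _ _ v∈O (p─q⊆p O V' u∈) (trans eq (proj₁ (proj₂ (U-occupant u u∈ (f∈U u u∈))))))
              (kept v∈C v∈O))
      φ-inj : ∀ v w → v ∈ C → w ∈ C → φ v ≡ φ w → v ≡ w
      φ-inj v w v∈ w∈ eq with v ∈? O | w ∈? O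
      ... | yes v∈O | yes w∈O = ψ-inj v w v∈O w∈O eq
      ... | yes v∈O | no w∉O = contradiction eq (mixed v∈ v∈O w∈ w∉O)
      ... | no v∉O | yes w∈O = contradiction (sym eq) (mixed w∈ w∈O v∈ v∉O)
      ... | no v∉O | no w∉O with new v∈ v∉O | new w∈ w∉O
      ...   | u , u∈ , refl | u' , u'∈ , refl = cong f (same-slot u∈ u'∈ (f∈U u u∈) (f∈U u' u'∈) eq)
      φ-mem : ∀ v → v ∈ C → v ∈ A (φ v)
      φ-mem v v∈ with v ∈? O
      ... | yes v∈O = ψ-mem v v∈O
      ... | no v∉O with new v∈ v∉O
      ...   | u , u∈ , refl = proj₂ (proj₂ (coloured (c v))) v
                (∈-∩ (proj₁ (U-occupant u u∈ (f∈U u u∈))) (∈-preimage⁺ c refl))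

-- Counting by numerical labels, colours and residues

injection-card-ℕ : (p : Subset n) (k : ℕ) (f : Fin n → ℕ) →
  (∀ {u v} → u ∈ p → v ∈ p → f u ≡ f v → u ≡ v) → (∀ {v} → v ∈ p → f v < k) → ∣ p ∣ ≤ k
injection-card-ℕ p zero f inj f< =
  -- No label lies below 0, so `p` is empty; the target is any set of size 0 whose ambient type has
  -- an element to map to.
  injection-card p (⊥ {1}) (λ _ → zero) (λ u∈ → contradiction (f< u∈) λ ()) (λ v∈ → contradiction (f< v∈) λ ())
injection-card-ℕ p (suc k) f inj f< =
  ≤-trans (injection-card p ⊤ (λ v → f v mod suc k) mod-inj (λ _ → ∈⊤)) (≤-reflexive (∣⊤∣≡n (suc k)))
  where
  toℕ-mod : ∀ {v} → v ∈ p → toℕ (f v mod suc k) ≡ f v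
  toℕ-mod {v} v∈ = trans (toℕ-fromℕ< (m%n<n (f v) (suc k))) (m<n⇒m%n≡m (f< v∈))
  mod-inj : ∀ {u v} → u ∈ p → v ∈ p → f u mod suc k ≡ f v mod suc k → u ≡ v
  mod-inj u∈ v∈ eq = inj u∈ v∈ (trans (sym (toℕ-mod u∈)) (trans (cong toℕ eq) (toℕ-mod v∈)))

-- Not the rank of a matroid: for `v` in `p`, its position in the increasing enumeration of `p`,
-- starting from 0.
rank : Subset n → Fin n → ℕ
rank (_ ∷ p) zero = 0
rank (inside ∷ p) (suc v) = suc (rank p v)
rank (outside ∷ p) (suc v) = rank p v

rank-< : (p : Subset n) {v : Fin n} → v ∈ p → rank p v < ∣ p ∣
rank-< (_ ∷ p) here = s≤s z≤n
rank-< (inside ∷ p) (there v∈) = s≤s (rank-< p v∈)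
rank-< (outside ∷ p) (there v∈) = rank-< p v∈

rank-injective : (p : Subset n) {u v : Fin n} → u ∈ p → v ∈ p → rank p u ≡ rank p v → u ≡ v
rank-injective (_ ∷ p) here here eq = refl
rank-injective (_ ∷ p) here (there v∈) ()
rank-injective (_ ∷ p) (there u∈) here ()
rank-injective (inside ∷ p) (there u∈) (there v∈) eq = cong suc (rank-injective p u∈ v∈ (suc-injective eq))
rank-injective (outside ∷ p) (there u∈) (there v∈) eq = cong suc (rank-injective p u∈ v∈ eq)

-- Induction on the number `l` of colours in use, splitting off the class of the last one. The set
-- `q` shrinks while the bound on the classes refers to the fixed set `p`.
colour-card : {τ k : ℕ} (c : Fin n → Fin τ) (p : Subset n) → (∀ j → ∣ p ∩ preimage c j ∣ ≤ k) →
  (l : ℕ) → l ≤ τ → (q : Subset n) → q ⊆ p → (∀ {v} → v ∈ q → toℕ (c v) < l) → ∣ q ∣ ≤ l * k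
colour-card c p fibre≤k zero l≤τ q q⊆p c< =
  injection-card-ℕ q 0 (toℕ ∘ c) (λ u∈ → contradiction (c< u∈) λ ()) c<
colour-card {k = k} c p fibre≤k (suc l) l<τ q q⊆p c< =
  ≤-trans (cover-card cover) (+-mono-≤ (fibre≤k j) (colour-card c p fibre≤k l (<⇒≤ l<τ) q′ (q⊆p ∘ p─q⊆p q _) c<l))
  where
  j = fromℕ< l<τ
  q′ = q ─ preimage c j
  cover : ∀ v → v ∈ q → v ∈ p ∩ preimage c j ⊎ v ∈ q′
  cover v v∈ with v ∈? preimage c j
  ... | yes v∈j = inj₁ (∈-∩ (q⊆p v∈) v∈j)
  ... | no v∉j = inj₂ (x∈p∧x∉q⇒x∈p─q v∈ v∉j)
  c<l : ∀ {v} → v ∈ q′ → toℕ (c v) < l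
  c<l v∈ = ≤∧≢⇒< (≤-pred (c< (p─q⊆p q _ v∈))) λ eq →
    ∈-─ʳ q _ v∈ (∈-preimage⁺ c (toℕ-injective (trans eq (sym (toℕ-fromℕ< l<τ)))))

-- Equal residues make `y` exceed `x` by a multiple `q * τ`, and this raises the quotient measured
-- from `a` by exactly `q`. Equal quotients hence force `q` to vanish.
residue-gap : (τ : ℕ) .{{_ : NonZero τ}} (a x y : ℕ) → a ≤ x → x ≤ y →
  x % τ ≡ y % τ → (x ∸ a) / τ ≡ (y ∸ a) / τ → x ≡ y
residue-gap τ a x y a≤x x≤y same-% same-/ = sym (trans y≡x+qτ (trans (cong (λ z → x + z * τ) q≡0) (+-identityʳ x)))
  where
  open ≡-Reasoning
  q = y / τ ∸ x / τ
  y≡x+qτ : y ≡ x + q * τ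
  y≡x+qτ = begin
    y                                 ≡⟨ m≡m%n+[m/n]*n y τ ⟩
    y % τ + y / τ * τ                 ≡⟨ cong₂ (λ r s → r + s * τ) (sym same-%) (sym (m+[n∸m]≡n (/-monoˡ-≤ τ x≤y))) ⟩
    x % τ + (x / τ + q) * τ           ≡⟨ cong (x % τ +_) (*-distribʳ-+ τ (x / τ) q) ⟩
    x % τ + (x / τ * τ + q * τ)       ≡⟨ sym (+-assoc (x % τ) _ _) ⟩
    x % τ + x / τ * τ + q * τ         ≡⟨ cong (_+ q * τ) (sym (m≡m%n+[m/n]*n x τ)) ⟩
    x + q * τ                         ∎
  q≡0 : q ≡ 0
  q≡0 = +-cancelˡ-≡ ((x ∸ a) / τ) q 0 (begin
    (x ∸ a) / τ + q                   ≡⟨ cong ((x ∸ a) / τ +_) (sym (m*n/n≡m q τ)) ⟩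
    (x ∸ a) / τ + q * τ / τ           ≡⟨ sym (+-distrib-/-∣ʳ (x ∸ a) (n∣m*n q)) ⟩
    (x ∸ a + q * τ) / τ               ≡⟨ cong (_/ τ) (sym (+-∸-comm (q * τ) a≤x)) ⟩
    (x + q * τ ∸ a) / τ               ≡⟨ cong (λ z → (z ∸ a) / τ) (sym y≡x+qτ) ⟩
    (y ∸ a) / τ                       ≡⟨ sym same-/ ⟩
    (x ∸ a) / τ                       ≡⟨ sym (+-identityʳ _) ⟩
    (x ∸ a) / τ + 0                   ∎)

-- Laminar matroids

Inside⊎Outside : Subset n → Subset n → Set
Inside⊎Outside P A = P ⊆ A ⊎ Disjoint P A

module LaminarFamily {n r : ℕ} (L : Fin r → Subset n) where

  -- Laminarity in the asymmetric form suited to a list with larger members first: the later member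
  -- `j` lies inside the earlier member `i` or avoids it.
  Nest : Fin r → Fin r → Set
  Nest i j = i ≢ j × Inside⊎Outside (L j) (L i)

  -- `A` is the region on which a recursion over the family currently works: everything, a member,
  -- or what remains after removing members. No member still to come may cross its boundary.
  Compatible : List (Fin r) → Subset n → Set
  Compatible F A = All (λ j → Inside⊎Outside (L j) A) F

  compatible-⊤ : (F : List (Fin r)) → Compatible F ⊤
  compatible-⊤ F = All.tabulate λ _ → inj₁ ⊆⊤

  compatible-member : ∀ {i F} → All (Nest i) F → Compatible F (L i)
  compatible-member = All.map proj₂

  ─-compatible : ∀ {i A j} → Nest i j → Inside⊎Outside (L j) A → Inside⊎Outside (L j) (A ─ L i)
  ─-compatible {i} {A} (_ , inj₁ j⊆i) _ = inj₂ λ v v∈j v∈ → ∈-─ʳ A (L i) v∈ (j⊆i v∈j)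
  ─-compatible (_ , inj₂ j#i) (inj₁ j⊆A) = inj₁ λ v∈j → x∈p∧x∉q⇒x∈p─q (j⊆A v∈j) (j#i _ v∈j)
  ─-compatible {i} {A} (_ , inj₂ j#i) (inj₂ j#A) = inj₂ λ v v∈j v∈ → j#A v v∈j (p─q⊆p A (L i) v∈)

  compatible-─ : ∀ {i F A} → All (Nest i) F → Compatible F A → Compatible F (A ─ L i)
  compatible-─ nest compatible = All.zipWith (λ (ni , co) → ─-compatible ni co) (nest , compatible)

  record Enumeration : Set where
    field
      members : List (Fin r)
      nested : AllPairs Nest members
      complete : ∀ i → i ∈ₗ members

  -- Sorting by decreasing size puts larger members first. If an earlier member is contained in a
  -- later one, their sizes force the two sets to coincide.
  descending : Laminar L → Enumeration
  descending laminar = record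
    { members = sort (allFin r)
    ; nested = AllPairs.zipWith (λ (≢ , ≥) → ≢ , nests ≥) (unique , Linked⇒AllPairs (λ p q → ≤-trans q p) (sort-↗ (allFin r)))
    ; complete = λ i → ∈-resp-↭ (↭-sym (sort-↭ (allFin r))) (∈-allFin i)
    }
    where
    open Sort (Flip.decTotalOrder (On.decTotalOrder ≤-decTotalOrder (λ i → ∣ L i ∣)))
    unique : Unique (sort (allFin r))
    unique = Unique-resp-↭ (setoid (Fin r)) (↭⇒↭ₛ (↭-sym (sort-↭ (allFin r)))) (allFin⁺ r)
    nests : ∀ {i j} → ∣ L j ∣ ≤ ∣ L i ∣ → Inside⊎Outside (L j) (L i)
    nests {i} {j} j≤i with laminar i j
    ... | inj₁ i#j = inj₂ λ v v∈j v∈i → i#j v v∈i v∈j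
    ... | inj₂ (inj₁ i⊆j) = inj₁ (⊆∧∣q∣≤∣p∣⇒⊇ i⊆j j≤i)
    ... | inj₂ (inj₂ j⊆i) = inj₁ j⊆i

  -- A linear arrangement of `S ∩ A` in which each listed member inside `A` occupies a window of
  -- length `∣ S ∩ L j ∣`. The field `bounded` allows two arrangements to be placed side by side.
  record Layout (S : Subset n) (F : List (Fin r)) (A : Subset n) : Set where
    field
      pos : Fin n → ℕ
      bounded : ∀ {v} → v ∈ S → v ∈ A → pos v < ∣ S ∩ A ∣
      injective : ∀ {u v} → u ∈ S → u ∈ A → v ∈ S → v ∈ A → pos u ≡ pos v → u ≡ v
      interval : ∀ {j} → j ∈ₗ F → L j ⊆ A →
        ∃ λ a → ∀ v → v ∈ S → v ∈ L j → a ≤ pos v × pos v < a + ∣ S ∩ L j ∣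

  -- The region is split at its first member: the elements of `L i` come first, the others follow
  -- with positions shifted by `∣ S ∩ L i ∣`. Every later member lies in one of the two halves or
  -- outside the region.
  layout : (S : Subset n) (F : List (Fin r)) (A : Subset n) → AllPairs Nest F → Compatible F A → Layout S F A
  layout S [] A _ _ = record
    { pos = rank (S ∩ A)
    ; bounded = λ v∈S v∈A → rank-< (S ∩ A) (∈-∩ v∈S v∈A)
    ; injective = λ u∈S u∈A v∈S v∈A → rank-injective (S ∩ A) (∈-∩ u∈S u∈A) (∈-∩ v∈S v∈A)
    ; interval = λ ()
    }
  layout S (i ∷ F) A (nest ∷ nests) (inj₂ i#A ∷ compatible) = record
    { pos = pos
    ; bounded = bounded
    ; injective = injective
    -- A member both inside and outside `A` is empty, so any left end serves.
    ; interval = λ { (here refl) i⊆A → 0 , λ v _ v∈i → contradiction (i⊆A v∈i) (i#A v v∈i)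
                   ; (there j∈) j⊆A → interval j∈ j⊆A }
    }
    where open Layout (layout S F A nests compatible)
  layout S (i ∷ F) A (nest ∷ nests) (inj₁ i⊆A ∷ compatible) = record
    { pos = pos
    ; bounded = bounded
    ; injective = injective
    ; interval = interval
    }
    where
    module I = Layout (layout S F (L i) nests (compatible-member nest))
    module R = Layout (layout S F (A ─ L i) nests (compatible-─ nest compatible))
    s = ∣ S ∩ L i ∣
    shift : ∀ v → Dec (v ∈ L i) → ℕ
    shift v (yes _) = I.pos v
    shift v (no _) = s + R.pos v
    pos : Fin n → ℕ
    pos v = shift v (v ∈? L i)
    pos-in : ∀ {v} → v ∈ L i → pos v ≡ I.pos v
    pos-in {v} v∈ with v ∈? L i
    ... | yes _ = refl
    ... | no v∉ = contradiction v∈ v∉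
    pos-out : ∀ {v} → v ∉ L i → pos v ≡ s + R.pos v
    pos-out {v} v∉ with v ∈? L i
    ... | yes v∈ = contradiction v∈ v∉
    ... | no _ = refl
    split : s + ∣ S ∩ (A ─ L i) ∣ ≤ ∣ S ∩ A ∣
    split = packing-card
      (λ v∈ → ∈-∩ (∈-∩ˡ S _ v∈) (i⊆A (∈-∩ʳ S _ v∈)))
      (λ v∈ → ∈-∩ (∈-∩ˡ S _ v∈) (p─q⊆p A _ (∈-∩ʳ S _ v∈)))
      (λ v v∈ v∈′ → ∈-─ʳ A _ (∈-∩ʳ S _ v∈′) (∈-∩ʳ S _ v∈))
    bounded : ∀ {v} → v ∈ S → v ∈ A → pos v < ∣ S ∩ A ∣
    bounded {v} v∈S v∈A with v ∈? L i
    ... | yes v∈i = <-≤-trans (I.bounded v∈S v∈i) (m+n≤o⇒m≤o s split)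
    ... | no v∉i = <-≤-trans (+-monoʳ-< s (R.bounded v∈S (x∈p∧x∉q⇒x∈p─q v∈A v∉i))) split
    apart : ∀ {u v} → u ∈ S → u ∈ L i → I.pos u ≢ s + R.pos v
    apart u∈S u∈i eq = <⇒≱ (I.bounded u∈S u∈i) (≤-trans (m≤m+n s _) (≤-reflexive (sym eq)))
    injective : ∀ {u v} → u ∈ S → u ∈ A → v ∈ S → v ∈ A → pos u ≡ pos v → u ≡ v
    injective {u} {v} u∈S u∈A v∈S v∈A eq with u ∈? L i | v ∈? L i
    ... | yes u∈ | yes v∈ = I.injective u∈S u∈ v∈S v∈ eq
    ... | yes u∈ | no _ = contradiction eq (apart u∈S u∈)
    ... | no _ | yes v∈ = contradiction (sym eq) (apart v∈S v∈)
    ... | no u∉ | no v∉ = R.injective u∈S (x∈p∧x∉q⇒x∈p─q u∈A u∉) v∈S (x∈p∧x∉q⇒x∈p─q v∈A v∉) (+-cancelˡ-≡ s _ _ eq)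
    interval : ∀ {j} → j ∈ₗ i ∷ F → L j ⊆ A → ∃ λ a → ∀ v → v ∈ S → v ∈ L j → a ≤ pos v × pos v < a + ∣ S ∩ L j ∣
    interval (here refl) _ = 0 , λ v v∈S v∈i → z≤n , subst (_< s) (sym (pos-in v∈i)) (I.bounded v∈S v∈i)
    interval {j} (there j∈) j⊆A with All.lookup nest j∈
    ... | _ , inj₁ j⊆i with I.interval j∈ j⊆i
    ...   | a , a-bounds = a , λ v v∈S v∈j →
            subst (λ x → a ≤ x × x < a + ∣ S ∩ L j ∣) (sym (pos-in (j⊆i v∈j))) (a-bounds v v∈S v∈j)
    interval {j} (there j∈) j⊆A | _ , inj₂ j#i with R.interval j∈ (λ v∈j → x∈p∧x∉q⇒x∈p─q (j⊆A v∈j) (j#i _ v∈j))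
    ...   | a , a-bounds = s + a , λ v v∈S v∈j →
            subst (λ x → s + a ≤ x × x < s + a + ∣ S ∩ L j ∣) (sym (pos-out (j#i v v∈j)))
              ( +-monoʳ-≤ s (proj₁ (a-bounds v v∈S v∈j))
              , <-≤-trans (+-monoʳ-< s (proj₂ (a-bounds v v∈S v∈j))) (≤-reflexive (sym (+-assoc s a _))))

-- Unions and bases of laminar matroids

module LaminarMatroid {n r : ℕ} (L : Fin r → Subset n) (k : Fin r → ℕ) (laminar : Laminar L) where

  open LaminarFamily L
  open Enumeration (descending laminar)

  laminar-union⁺ : (τ : ℕ) → 1 ≤ τ → (S : Subset n) → (∀ i → ∣ S ∩ L i ∣ ≤ τ * k i) → UnionIndep (LaminarIndep L k) τ S
  laminar-union⁺ (suc τ-1) _ S S≤ = c , fibre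
    where
    open Layout (layout S members ⊤ nested (compatible-⊤ members))
    τ = suc τ-1
    c : Fin n → Fin τ
    c v = pos v mod τ
    residue : ∀ {j v} → v ∈ preimage c j → pos v % τ ≡ toℕ j
    residue {j} {v} v∈ = trans (sym (toℕ-fromℕ< (m%n<n (pos v) τ))) (cong toℕ (∈-preimage⁻ c j v∈))
    fibre : ∀ j i → ∣ (S ∩ preimage c j) ∩ L i ∣ ≤ k i
    fibre j i with interval (complete i) ⊆⊤
    -- Among elements of one residue the quotient of the distance from `a` identifies the element,
    -- and a window of length at most `τ * k i` admits at most `k i` quotients.
    ... | a , bounds = injection-card-ℕ _ (k i) (λ v → (pos v ∸ a) / τ) inj small
      where
      p = (S ∩ preimage c j) ∩ L i
      ∈S : ∀ {v} → v ∈ p → v ∈ S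
      ∈S = ∈-∩ˡ S _ ∘ ∈-∩ˡ _ (L i)
      ∈L : ∀ {v} → v ∈ p → v ∈ L i
      ∈L = ∈-∩ʳ _ (L i)
      pos% : ∀ {v} → v ∈ p → pos v % τ ≡ toℕ j
      pos% = residue ∘ ∈-∩ʳ S _ ∘ ∈-∩ˡ _ (L i)
      a≤ : ∀ {v} → v ∈ p → a ≤ pos v
      a≤ v∈ = proj₁ (bounds _ (∈S v∈) (∈L v∈))
      small : ∀ {v} → v ∈ p → (pos v ∸ a) / τ < k i
      small {v} v∈ = m<n*o⇒m/o<n (<-≤-trans
        (+-cancelˡ-< a _ _ (≤-trans (≤-reflexive (cong suc (m+[n∸m]≡n (a≤ v∈)))) (proj₂ (bounds _ (∈S v∈) (∈L v∈)))))
        (≤-trans (S≤ i) (≤-reflexive (*-comm τ (k i)))))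
      inj : ∀ {u v} → u ∈ p → v ∈ p → (pos u ∸ a) / τ ≡ (pos v ∸ a) / τ → u ≡ v
      inj {u} {v} u∈ v∈ eq = injective (∈S u∈) ∈⊤ (∈S v∈) ∈⊤ (same-pos (≤-total (pos u) (pos v)))
        where
        same-pos : pos u ≤ pos v ⊎ pos v ≤ pos u → pos u ≡ pos v
        same-pos (inj₁ u≤v) = residue-gap τ a _ _ (a≤ u∈) u≤v (trans (pos% u∈) (sym (pos% v∈))) eq
        same-pos (inj₂ v≤u) = sym (residue-gap τ a _ _ (a≤ v∈) v≤u (trans (pos% v∈) (sym (pos% u∈))) (sym eq))

  laminar-union⁻ : {τ : ℕ} {S : Subset n} → UnionIndep (LaminarIndep L k) τ S → ∀ i → ∣ S ∩ L i ∣ ≤ τ * k i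
  laminar-union⁻ {τ} {S} (c , coloured) i =
    colour-card c (S ∩ L i) fibre τ ≤-refl (S ∩ L i) id (λ {v} _ → toℕ<n (c v))
    where
    fibre : ∀ j → ∣ (S ∩ L i) ∩ preimage c j ∣ ≤ k i
    fibre j = ≤-trans (p⊆q⇒∣p∣≤∣q∣ λ v∈ →
      ∈-∩ (∈-∩ (∈-∩ˡ S _ (∈-∩ˡ _ _ v∈)) (∈-∩ʳ (S ∩ L i) _ v∈)) (∈-∩ʳ S _ (∈-∩ˡ _ _ v∈))) (coloured j i)

  some-violated : (f g : Fin r → ℕ) → ¬ (∀ i → f i ≤ g i) → ∃ λ i → g i < f i
  some-violated f g ¬≤ with any? (λ i → g i <? f i)
  ... | yes found = found
  ... | no none = contradiction (λ i → ≮⇒≥ (λ g<f → none (i , g<f))) ¬≤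

  -- Adding `u` raises a count by at most one, and only in members containing `u`; so a member whose
  -- bound breaks contains `u` and was already full. The bound `b` is general to serve both `k` and
  -- its multiple by `τ`.
  tight-member : {S : Subset n} {u : Fin n} (b : Fin r → ℕ) → (∀ i → ∣ S ∩ L i ∣ ≤ b i) →
    ¬ (∀ i → ∣ (S ∪ ⁅ u ⁆) ∩ L i ∣ ≤ b i) → ∃ λ i → u ∈ L i × b i ≤ ∣ S ∩ L i ∣
  tight-member {S} {u} b S≤b ¬≤b with some-violated (λ i → ∣ (S ∪ ⁅ u ⁆) ∩ L i ∣) b ¬≤b
  ... | i , b< with u ∈? L i
  ...   | yes u∈i = i , u∈i , ≤-pred (≤-trans b< (begin
      ∣ (S ∪ ⁅ u ⁆) ∩ L i ∣     ≤⟨ cover-card cover ⟩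
      ∣ ⁅ u ⁆ ∣ + ∣ S ∩ L i ∣   ≡⟨ cong (_+ ∣ S ∩ L i ∣) (∣⁅x⁆∣≡1 u) ⟩
      suc ∣ S ∩ L i ∣           ∎))
    where
    open ≤-Reasoning
    cover : ∀ v → v ∈ (S ∪ ⁅ u ⁆) ∩ L i → v ∈ ⁅ u ⁆ ⊎ v ∈ S ∩ L i
    cover v v∈ with x∈p∪q⁻ S ⁅ u ⁆ (∈-∩ˡ _ (L i) v∈)
    ... | inj₁ v∈S = inj₂ (∈-∩ v∈S (∈-∩ʳ _ (L i) v∈))
    ... | inj₂ v∈u = inj₁ v∈u
  ...   | no u∉i = contradiction (≤-trans b< (≤-trans (p⊆q⇒∣p∣≤∣q∣ drop-u) (S≤b i))) (<-irrefl refl)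
    where
    drop-u : (S ∪ ⁅ u ⁆) ∩ L i ⊆ S ∩ L i
    drop-u v∈ with x∈p∪q⁻ S ⁅ u ⁆ (∈-∩ˡ _ (L i) v∈)
    ... | inj₁ v∈S = ∈-∩ v∈S (∈-∩ʳ _ (L i) v∈)
    ... | inj₂ v∈u = contradiction (subst (_∈ L i) (x∈⁅y⁆⇒x≡y u v∈u) (∈-∩ʳ _ (L i) v∈)) u∉i

  -- Peeling off the outermost members in which O dominates D.
  dominated : (O D : Subset n) (F : List (Fin r)) (A : Subset n) → AllPairs Nest F → Compatible F A →
    (∀ w → w ∈ D → w ∉ O → w ∈ A → ∃ λ j → j ∈ₗ F × w ∈ L j × ∣ D ∩ L j ∣ ≤ ∣ O ∩ L j ∣) →
    ∣ D ∩ A ∣ ≤ ∣ O ∩ A ∣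
  dominated O D [] A _ _ covered = p⊆q⇒∣p∣≤∣q∣ ⊆O
    where
    ⊆O : D ∩ A ⊆ O ∩ A
    ⊆O {v} v∈ with v ∈? O
    ... | yes v∈O = ∈-∩ v∈O (∈-∩ʳ D A v∈)
    ... | no v∉O with covered v (∈-∩ˡ D A v∈) v∉O (∈-∩ʳ D A v∈)
    ...   | _ , () , _
  dominated O D (i ∷ F) A (nest ∷ nests) (position ∷ compatible) covered
    with position | ∣ D ∩ L i ∣ ≤? ∣ O ∩ L i ∣
  ... | inj₂ i#A | _ = dominated O D F A nests compatible covered′
    where
    covered′ : ∀ w → w ∈ D → w ∉ O → w ∈ A → ∃ λ j → j ∈ₗ F × w ∈ L j × ∣ D ∩ L j ∣ ≤ ∣ O ∩ L j ∣
    covered′ w w∈D w∉O w∈A with covered w w∈D w∉O w∈A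
    ... | j , here refl , w∈j , _ = contradiction w∈A (i#A w w∈j)
    ... | j , there j∈ , rest = j , j∈ , rest
  ... | inj₁ _ | no D≰O = dominated O D F A nests compatible covered′
    where
    covered′ : ∀ w → w ∈ D → w ∉ O → w ∈ A → ∃ λ j → j ∈ₗ F × w ∈ L j × ∣ D ∩ L j ∣ ≤ ∣ O ∩ L j ∣
    covered′ w w∈D w∉O w∈A with covered w w∈D w∉O w∈A
    ... | j , here refl , _ , D≤O = contradiction D≤O D≰O
    ... | j , there j∈ , rest = j , j∈ , rest
  ... | inj₁ i⊆A | yes D≤O = begin
    ∣ D ∩ A ∣                               ≤⟨ cover-card cover ⟩
    ∣ D ∩ L i ∣ + ∣ D ∩ (A ─ L i) ∣         ≤⟨ +-mono-≤ D≤O (dominated O D F (A ─ L i) nests (compatible-─ nest compatible) covered′) ⟩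
    ∣ O ∩ L i ∣ + ∣ O ∩ (A ─ L i) ∣         ≤⟨ packing-card
      (λ v∈ → ∈-∩ (∈-∩ˡ O _ v∈) (i⊆A (∈-∩ʳ O _ v∈)))
      (λ v∈ → ∈-∩ (∈-∩ˡ O _ v∈) (p─q⊆p A _ (∈-∩ʳ O _ v∈)))
      (λ v v∈ v∈′ → ∈-─ʳ A _ (∈-∩ʳ O _ v∈′) (∈-∩ʳ O _ v∈)) ⟩
    ∣ O ∩ A ∣                               ∎
    where
    open ≤-Reasoning
    cover : ∀ v → v ∈ D ∩ A → v ∈ D ∩ L i ⊎ v ∈ D ∩ (A ─ L i)
    cover v v∈ with v ∈? L i
    ... | yes v∈i = inj₁ (∈-∩ (∈-∩ˡ D A v∈) v∈i)
    ... | no v∉i = inj₂ (∈-∩ (∈-∩ˡ D A v∈) (x∈p∧x∉q⇒x∈p─q (∈-∩ʳ D A v∈) v∉i))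
    covered′ : ∀ w → w ∈ D → w ∉ O → w ∈ A ─ L i → ∃ λ j → j ∈ₗ F × w ∈ L j × ∣ D ∩ L j ∣ ≤ ∣ O ∩ L j ∣
    covered′ w w∈D w∉O w∈ with covered w w∈D w∉O (p─q⊆p A _ w∈)
    ... | j , here refl , w∈j , _ = contradiction w∈j (∈-─ʳ A _ w∈)
    ... | j , there j∈ , rest = j , j∈ , rest

  -- Maximality of `O` puts each element of `D` outside `O` into a member filled by `O`, where the
  -- independent set `D` cannot have more elements. This is the covering that `dominated` asks for.
  laminar-largest : BaseIsLargest (LaminarIndep L k)
  laminar-largest O D (O-indep , maximal) D-indep = begin
    ∣ D ∣       ≡⟨ cong ∣_∣ (sym (∩-identityʳ D)) ⟩
    ∣ D ∩ ⊤ ∣   ≤⟨ dominated O D members ⊤ nested (compatible-⊤ members) covered ⟩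
    ∣ O ∩ ⊤ ∣   ≤⟨ ∣p∩q∣≤∣p∣ O ⊤ ⟩
    ∣ O ∣       ∎
    where
    open ≤-Reasoning
    covered : ∀ w → w ∈ D → w ∉ O → w ∈ ⊤ → ∃ λ j → j ∈ₗ members × w ∈ L j × ∣ D ∩ L j ∣ ≤ ∣ O ∩ L j ∣
    covered w _ w∉O _ with tight-member {O} {w} k O-indep (maximal w w∉O)
    ... | j , w∈j , k≤ = j , complete j , w∈j , ≤-trans (D-indep j) k≤

-- Packing blocks into a laminar family

hit : Subset n → Subset n → ℕ
hit p q with nonempty? (p ∩ q)
... | yes _ = 1
... | no _ = 0

-- Blocks are counted rather than elements: a choice of one element from each block can put no more
-- elements into `p` than there are blocks meeting `p`.
meets : Subset n → List (Subset n) → ℕ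
meets p [] = 0
meets p (q ∷ qs) = hit p q + meets p qs

hit≤1 : (p q : Subset n) → hit p q ≤ 1
hit≤1 p q with nonempty? (p ∩ q)
... | yes _ = ≤-refl
... | no _ = z≤n

hit-mono : {p q q′ : Subset n} → (∀ v → v ∈ p → v ∈ q → v ∈ q′) → hit p q ≤ hit p q′
hit-mono {p = p} {q} {q′} sub with nonempty? (p ∩ q) | nonempty? (p ∩ q′)
... | yes _ | yes _ = ≤-refl
... | no _ | _ = z≤n
... | yes (v , v∈) | no empty =
  contradiction (v , ∈-∩ (∈-∩ˡ p q v∈) (sub v (∈-∩ˡ p q v∈) (∈-∩ʳ p q v∈))) empty

hit-disjoint : {p q : Subset n} → Disjoint p q → hit p q ≡ 0
hit-disjoint {p = p} {q} p#q with nonempty? (p ∩ q)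
... | yes (v , v∈) = contradiction (∈-∩ʳ p q v∈) (p#q v (∈-∩ˡ p q v∈))
... | no _ = refl

hit-common : {p q : Subset n} {v : Fin n} → v ∈ p → v ∈ q → hit p q ≡ 1
hit-common {p = p} {q} {v} v∈p v∈q with nonempty? (p ∩ q)
... | yes _ = refl
... | no empty = contradiction (v , ∈-∩ v∈p v∈q) empty

meets-++ : (p : Subset n) (qs qs′ : List (Subset n)) → meets p (qs ++ qs′) ≡ meets p qs + meets p qs′
meets-++ p [] qs′ = refl
meets-++ p (q ∷ qs) qs′ = trans (cong (hit p q +_) (meets-++ p qs qs′)) (sym (+-assoc (hit p q) _ _))

meets≤length : (p : Subset n) (qs : List (Subset n)) → meets p qs ≤ length qs
meets≤length p [] = z≤n
meets≤length p (q ∷ qs) = +-mono-≤ (hit≤1 p q) (meets≤length p qs)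

meets-disjoint : {p : Subset n} {qs : List (Subset n)} → All (Disjoint p) qs → meets p qs ≡ 0
meets-disjoint [] = refl
meets-disjoint {p = p} {q ∷ qs} (p#q ∷ p#qs) rewrite hit-disjoint {p = p} {q} p#q = meets-disjoint p#qs

meets-take : (p : Subset n) (c : ℕ) (qs : List (Subset n)) → meets p (take c qs) ≤ meets p qs
meets-take p zero qs = z≤n
meets-take p (suc c) [] = z≤n
meets-take p (suc c) (q ∷ qs) = +-monoʳ-≤ (hit p q) (meets-take p c qs)

meets-zip : (p : Subset n) (us : List (Fin n)) (qs : List (Subset n)) →
  meets p (map proj₂ (zip us qs)) + meets p (drop (length us) qs) ≤ meets p qs
meets-zip p [] qs = ≤-refl
meets-zip p (u ∷ us) [] = z≤n
meets-zip p (u ∷ us) (q ∷ qs) =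
  ≤-trans (≤-reflexive (+-assoc (hit p q) _ _)) (+-monoʳ-≤ (hit p q) (meets-zip p us qs))

meets≥1 : {p q : Subset n} {v : Fin n} {qs : List (Subset n)} → v ∈ p → v ∈ q → q ∈ₗ qs → 1 ≤ meets p qs
meets≥1 v∈p v∈q (here refl) = ≤-trans (≤-reflexive (sym (hit-common v∈p v∈q))) (m≤m+n _ _)
meets≥1 {p = p} {qs = q ∷ _} v∈p v∈q (there q∈) = ≤-trans (meets≥1 v∈p v∈q q∈) (m≤n+m _ (hit p q))

-- Different labels place the two entries at different positions of the list, even if their blocks
-- are equal as sets.
meets≥2 : {A : Set} {p q q′ : Subset n} {v : Fin n} {a a′ : A} {qs : List (A × Subset n)} →
  v ∈ p → v ∈ q → v ∈ q′ → a ≢ a′ → (a , q) ∈ₗ qs → (a′ , q′) ∈ₗ qs → 2 ≤ meets p (map proj₂ qs)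
meets≥2 v∈p v∈q v∈q′ a≢a′ (here refl) (here refl) = contradiction refl a≢a′
meets≥2 v∈p v∈q v∈q′ a≢a′ (here refl) (there q′∈) =
  +-mono-≤ (≤-reflexive (sym (hit-common v∈p v∈q))) (meets≥1 v∈p v∈q′ (∈-map⁺ proj₂ q′∈))
meets≥2 v∈p v∈q v∈q′ a≢a′ (there q∈) (here refl) =
  +-mono-≤ (≤-reflexive (sym (hit-common v∈p v∈q′))) (meets≥1 v∈p v∈q (∈-map⁺ proj₂ q∈))
meets≥2 {p = p} {qs = (_ , q) ∷ _} v∈p v∈q v∈q′ a≢a′ (there q∈) (there q′∈) =
  ≤-trans (meets≥2 v∈p v∈q v∈q′ a≢a′ q∈ q′∈) (m≤n+m _ (hit p q))

-- Peeling off the first block removes at most one element of `s`, and if that element lies in `p`,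
-- the block meets `p` and is counted.
partial-transversal-card : (p : Subset n) (qs : List (Subset n)) (s : Subset n) →
  (∀ {v} → v ∈ s → ∃ λ q → q ∈ₗ qs × v ∈ q) →
  (∀ {q u v} → q ∈ₗ qs → u ∈ s → u ∈ q → v ∈ s → v ∈ q → u ≡ v) →
  ∣ s ∩ p ∣ ≤ meets p qs
partial-transversal-card p [] s covered _ =
  injection-card-ℕ (s ∩ p) 0 (λ _ → 0) (λ u∈ → absurd (covered (∈-∩ˡ s p u∈))) (λ u∈ → absurd (covered (∈-∩ˡ s p u∈)))
  where
  absurd : {A : Set} {v : Fin _} → (∃ λ q → q ∈ₗ [] × v ∈ q) → A
  absurd (_ , () , _)
partial-transversal-card {n} p (q ∷ qs) s covered one =
  ≤-trans (cover-card cover) (+-mono-≤ head-card (partial-transversal-card p qs (s ─ q) covered′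
    (λ q∈ u∈ u∈q v∈ v∈q → one (there q∈) (p─q⊆p s q u∈) u∈q (p─q⊆p s q v∈) v∈q)))
  where
  cover : ∀ v → v ∈ s ∩ p → v ∈ (s ∩ q) ∩ p ⊎ v ∈ (s ─ q) ∩ p
  cover v v∈ with v ∈? q
  ... | yes v∈q = inj₁ (∈-∩ (∈-∩ (∈-∩ˡ s p v∈) v∈q) (∈-∩ʳ s p v∈))
  ... | no v∉q = inj₂ (∈-∩ (x∈p∧x∉q⇒x∈p─q (∈-∩ˡ s p v∈) v∉q) (∈-∩ʳ s p v∈))
  head-card : ∣ (s ∩ q) ∩ p ∣ ≤ hit p q
  head-card = injection-card-ℕ _ (hit p q) (λ _ → 0)
    (λ u∈ v∈ _ → one (here refl) (∈-∩ˡ s q (∈-∩ˡ _ p u∈)) (∈-∩ʳ s q (∈-∩ˡ _ p u∈))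
                                 (∈-∩ˡ s q (∈-∩ˡ _ p v∈)) (∈-∩ʳ s q (∈-∩ˡ _ p v∈)))
    (λ v∈ → ≤-reflexive (sym (hit-common (∈-∩ʳ _ p v∈) (∈-∩ʳ s q (∈-∩ˡ _ p v∈)))))
  covered′ : ∀ {v} → v ∈ s ─ q → ∃ λ q′ → q′ ∈ₗ qs × v ∈ q′
  covered′ v∈ with covered (p─q⊆p s q v∈)
  ... | _ , here refl , v∈q = contradiction v∈q (∈-─ʳ s q v∈)
  ... | q′ , there q′∈ , v∈q′ = q′ , q′∈ , v∈q′

zip-proj₁ : {A B : Set} (xs : List A) (ys : List B) → length xs ≤ length ys → map proj₁ (zip xs ys) ≡ xs
zip-proj₁ [] ys _ = refl
zip-proj₁ (x ∷ xs) (y ∷ ys) (s≤s ≤) = cong (x ∷_) (zip-proj₁ xs ys ≤)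

all-zip : {A B : Set} {P : A → Set} {Q : B → Set} {xs : List A} {ys : List B} →
  All P xs → All Q ys → All (λ xy → P (proj₁ xy) × Q (proj₂ xy)) (zip xs ys)
all-zip [] _ = []
all-zip (_ ∷ _) [] = []
all-zip (px ∷ pxs) (qy ∷ qys) = (px , qy) ∷ all-zip pxs qys

unique-length : (p : Subset n) {us : List (Fin n)} → Unique us → All (_∈ p) us → length us ≤ ∣ p ∣
unique-length p [] [] = z≤n
unique-length p (u∉us ∷ unique) (u∈p ∷ us∈p) = ≤-<-trans
  (unique-length (p - _) unique (All.zipWith (λ (u≢w , w∈p) → x∈p∧x≢y⇒x∈p-y w∈p (u≢w ∘ sym)) (u∉us , us∈p)))
  (x∈p⇒∣p-x∣<∣p∣ u∈p)

lookupOr⊥ : List (Fin n × Subset n) → Fin n → Subset n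
lookupOr⊥ [] u = ⊥
lookupOr⊥ ((w , q) ∷ qs) u with w ≟ u
... | yes _ = q
... | no _ = lookupOr⊥ qs u

lookupOr⊥-∈ : (qs : List (Fin n × Subset n)) {u : Fin n} → u ∈ₗ map proj₁ qs → (u , lookupOr⊥ qs u) ∈ₗ qs
lookupOr⊥-∈ ((w , q) ∷ qs) {u} u∈ with w ≟ u
... | yes refl = here refl
... | no w≢u with u∈
...   | here refl = contradiction refl w≢u
...   | there u∈qs = there (lookupOr⊥-∈ qs u∈qs)

-- Cutting sets into blocks

Blocks : ℕ → Subset n → List (Subset n) → Set
Blocks t p = All (λ q → q ⊆ p × ∣ q ∣ ≡ t)

blocks-⊆ : {t : ℕ} {p p′ : Subset n} {qs : List (Subset n)} → p ⊆ p′ → Blocks t p qs → Blocks t p′ qs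
blocks-⊆ p⊆p′ = All.map λ (q⊆p , size) → p⊆p′ ∘ q⊆p , size

blocks-disjoint : {t : ℕ} {p p′ : Subset n} {qs : List (Subset n)} → Disjoint p′ p → Blocks t p qs → meets p′ qs ≡ 0
blocks-disjoint p′#p = meets-disjoint ∘ All.map λ (q⊆p , _) v v∈p′ v∈q → p′#p v v∈p′ (q⊆p v∈q)

-- Pairwise disjointness of `rest` and the blocks is expressed in `single` by counting, the same
-- form in which the caps of members are stated.
record Chopped (t : ℕ) (s : Subset n) : Set where
  field
    rest : Subset n
    blocks : List (Subset n)
    rest⊆ : rest ⊆ s
    rest< : ∣ rest ∣ < t
    blocks-ok : Blocks t s blocks
    single : ∀ v → hit ⁅ v ⁆ rest + meets ⁅ v ⁆ blocks ≤ 1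
    size : ∣ s ∣ ≤ t * length blocks + ∣ rest ∣

chop : (t : ℕ) → 1 ≤ t → (d : ℕ) (s : Subset n) → ∣ s ∣ ≤ d → Chopped t s
chop t 1≤t d s s≤d with t ≤? ∣ s ∣
... | no t≰s = record
  { rest = s ; blocks = [] ; rest⊆ = id ; rest< = ≰⇒> t≰s ; blocks-ok = []
  ; single = λ v → ≤-trans (≤-reflexive (+-identityʳ _)) (hit≤1 ⁅ v ⁆ s) ; size = m≤n+m _ _ }
chop t 1≤t zero s s≤d | yes t≤s = contradiction (≤-trans 1≤t (≤-trans t≤s s≤d)) λ ()
chop {n} t 1≤t (suc d) s s≤d | yes t≤s with subset-of-size t s t≤s
... | q , q⊆s , ∣q∣≡t = record
  { rest = rest ; blocks = q ∷ blocks ; rest⊆ = p─q⊆p s q ∘ rest⊆ ; rest< = rest<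
  ; blocks-ok = (q⊆s , ∣q∣≡t) ∷ blocks-⊆ (p─q⊆p s q) blocks-ok
  ; single = single′
  ; size = size′
  }
  where
  smaller : ∣ s ─ q ∣ ≤ d
  smaller = ≤-pred (begin
    suc ∣ s ─ q ∣               ≤⟨ +-monoˡ-≤ ∣ s ─ q ∣ (≤-trans 1≤t (≤-reflexive (sym ∣q∣≡t))) ⟩
    ∣ q ∣ + ∣ s ─ q ∣           ≤⟨ packing-card q⊆s (p─q⊆p s q) (λ v v∈q v∈ → ∈-─ʳ s q v∈ v∈q) ⟩
    ∣ s ∣                       ≤⟨ s≤d ⟩
    suc d                       ∎)
    where open ≤-Reasoning
  open Chopped (chop t 1≤t d (s ─ q) smaller)
  size′ : ∣ s ∣ ≤ t * suc (length blocks) + ∣ rest ∣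
  size′ = begin
    ∣ s ∣                                       ≡⟨ ∣p∣≡∣p∩q∣+∣p─q∣ s q ⟩
    ∣ s ∩ q ∣ + ∣ s ─ q ∣                       ≤⟨ +-mono-≤ (≤-trans (∣p∩q∣≤∣q∣ s q) (≤-reflexive ∣q∣≡t)) size ⟩
    t + (t * length blocks + ∣ rest ∣)          ≡⟨ sym (+-assoc t _ _) ⟩
    t + t * length blocks + ∣ rest ∣            ≡⟨ cong (_+ ∣ rest ∣) (sym (*-suc t (length blocks))) ⟩
    t * suc (length blocks) + ∣ rest ∣          ∎
    where open ≤-Reasoning
  apart : ∀ {v} → v ∈ q → Disjoint ⁅ v ⁆ (s ─ q)
  apart {v} v∈q w w∈ w∈─ = ∈-─ʳ s q w∈─ (subst (_∈ q) (sym (x∈⁅y⁆⇒x≡y v w∈)) v∈q)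
  single′ : ∀ v → hit ⁅ v ⁆ rest + (hit ⁅ v ⁆ q + meets ⁅ v ⁆ blocks) ≤ 1
  single′ v with v ∈? q
  ... | no v∉q rewrite hit-disjoint {p = ⁅ v ⁆} {q} (λ w w∈ w∈q → v∉q (subst (_∈ q) (x∈⁅y⁆⇒x≡y v w∈) w∈q)) = single v
  ... | yes v∈q rewrite hit-disjoint {p = ⁅ v ⁆} {rest} (λ w w∈ w∈rest → apart v∈q w w∈ (rest⊆ w∈rest))
                      | blocks-disjoint {p′ = ⁅ v ⁆} (apart v∈q) blocks-ok = ≤-trans (≤-reflexive (+-identityʳ _)) (hit≤1 ⁅ v ⁆ q)

record Settled (t τ : ℕ) (s : Subset n) : Set where
  field
    rest : Subset n
    blocks : List (Subset n)
    rest⊆ : rest ⊆ s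
    rest< : ∣ rest ∣ < t
    blocks-ok : Blocks t s blocks
    lighter : ∀ p → hit p rest + meets p blocks ≤ hit p s
    size : ∣ s ∣ ≤ τ → ∣ s ∣ ≤ τ * length blocks + ∣ rest ∣

-- At most one block is cut, and the elements left over are then discarded: keeping them pending
-- beside the block could let a member meet two sets where it met one. The block is charged `τ` to
-- pay for the discarded elements as well.
settle : (t τ : ℕ) → 1 ≤ t → (s : Subset n) → Settled t τ s
settle {n} t τ 1≤t s with t ≤? ∣ s ∣
... | no t≰s = record
  { rest = s ; blocks = [] ; rest⊆ = id ; rest< = ≰⇒> t≰s ; blocks-ok = []
  ; lighter = λ p → ≤-reflexive (+-identityʳ _) ; size = λ _ → m≤n+m _ _ }
... | yes t≤s with subset-of-size t s t≤s
...   | q , q⊆s , ∣q∣≡t = record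
  { rest = ⊥ ; blocks = q ∷ [] ; rest⊆ = ⊥⊆ ; rest< = ≤-trans (s≤s (≤-reflexive (∣⊥∣≡0 n))) 1≤t
  ; blocks-ok = (q⊆s , ∣q∣≡t) ∷ []
  ; lighter = λ p → begin
      hit p ⊥ + (hit p q + 0)   ≡⟨ cong₂ _+_ (hit-disjoint {p = p} (λ _ _ → ∉⊥)) (+-identityʳ (hit p q)) ⟩
      hit p q                   ≤⟨ hit-mono {p = p} (λ _ _ v∈q → q⊆s v∈q) ⟩
      hit p s                   ∎
  ; size = λ s≤τ → ≤-trans s≤τ (≤-trans (≤-reflexive (sym (*-identityʳ τ))) (m≤m+n _ _)) }
  where open ≤-Reasoning

-- The pending set counts like a block because it may turn into one later; the caps then remain
-- valid.
load : Subset n → Subset n → List (Subset n) → List (Fin n × Subset n) → ℕ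
load p pending free owned = hit p pending + (meets p free + meets p (map proj₂ owned))

load≤ : (p pending : Subset n) (free : List (Subset n)) (owned : List (Fin n × Subset n)) →
  load p pending free owned ≤ suc (length free + length owned)
load≤ p pending free owned = +-mono-≤ (hit≤1 p pending) (+-mono-≤ (meets≤length p free)
  (≤-trans (meets≤length p (map proj₂ owned)) (≤-reflexive (length-map proj₂ owned))))

-- Grouping blocks along the laminar tree

module Packing {n r : ℕ} (L : Fin r → Subset n) (k : Fin r → ℕ) (V' O : Subset n) (T : Fin n → Fin r) (t τ : ℕ)
  (1≤t : 1 ≤ t) (t≤τ : t ≤ τ)
  (V'-bounded : ∀ i → ∣ V' ∩ L i ∣ ≤ τ * k i) (O-indep : ∀ i → ∣ O ∩ L i ∣ ≤ k i)
  (T-member : ∀ u → u ∈ O ─ V' → u ∈ L (T u)) (T-tight : ∀ u → u ∈ O ─ V' → τ * k (T u) ≤ ∣ V' ∩ L (T u) ∣)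
  (separated : 2 * t ≤ τ ⊎ (∀ i j → i ≢ j → Disjoint (L i) (L j))) where

  open LaminarFamily L

  X Z : Subset n
  X = V' ─ O
  Z = V' ∩ O

  -- The situations in which the count can be guaranteed: either merges are affordable, or no listed
  -- member meets the region and no merge takes place there.
  Roomy : List (Fin r) → Subset n → Set
  Roomy F A = 2 * t ≤ τ ⊎ (∀ {j} → j ∈ₗ F → Disjoint (L j) A)

  -- A block inside `L (T u)` consists of elements at least as heavy as `u`, by the choice of `T`.
  -- Membership of `T u` in `F` separates earlier owners from those added when a further member is
  -- closed.
  Owner : List (Fin r) → Subset n → Fin n × Subset n → Set
  Owner F A (u , q) = u ∈ O ─ V' × u ∈ A × T u ∈ₗ F × (∀ v → v ∈ q → v ∈ L (T u))

  -- Disjoint t-blocks of X ∩ A, some owned by elements of O ─ V', and fewer than t pending elements.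
  -- In count every block or kept element of O pays for τ elements of V' ∩ A, wasted ones included,
  -- so a member that is tight in τM contains enough blocks for its owners.
  record Grouping (F : List (Fin r)) (A : Subset n) : Set where
    field
      pending : Subset n
      free : List (Subset n)
      owned : List (Fin n × Subset n)
      pending⊆ : pending ⊆ X ∩ A
      pending< : ∣ pending ∣ < t
      free-ok : Blocks t (X ∩ A) free
      owned-ok : Blocks t (X ∩ A) (map proj₂ owned)
      owners : All (Owner F A) owned
      unique : Unique (map proj₁ owned)
      served : ∀ {u} → u ∈ O ─ V' → u ∈ A → T u ∈ₗ F → u ∈ₗ map proj₁ owned
      single : ∀ v → load ⁅ v ⁆ pending free owned ≤ 1
      capped : ∀ {j} → j ∈ₗ F → load (L j) pending free owned + ∣ Z ∩ L j ∣ ≤ k j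
      count : Roomy F A → ∣ V' ∩ A ∣ ≤ τ * (length free + length owned + ∣ Z ∩ A ∣) + ∣ pending ∣

    load-outside : ∀ {p} → Disjoint p A → load p pending free owned ≡ 0
    load-outside {p} p#A = cong₂ _+_ (hit-disjoint {p = p} (λ v v∈p v∈ → p#A v v∈p (∈-∩ʳ X A (pending⊆ v∈))))
      (cong₂ _+_ (blocks-disjoint p#XA free-ok) (blocks-disjoint p#XA owned-ok))
      where
      p#XA : Disjoint p (X ∩ A)
      p#XA v v∈p v∈ = p#A v v∈p (∈-∩ʳ X A v∈)

  Z≤k : ∀ i → ∣ Z ∩ L i ∣ ≤ k i
  Z≤k i = ≤-trans (p⊆q⇒∣p∣≤∣q∣ (∩-monoˡ-⊆ (L i) (p∩q⊆q V' O))) (O-indep i)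

  -- No listed member restricts the cutting, so `X ∩ A` is chopped until fewer than `t` elements are
  -- left. Each block accounts for `t` of the `τ` elements it is charged for, and each kept element
  -- of `O` for one.
  group-leaf : (A : Subset n) → Grouping [] A
  group-leaf A = record
    { pending = rest ; free = blocks ; owned = [] ; pending⊆ = rest⊆ ; pending< = rest<
    ; free-ok = blocks-ok ; owned-ok = [] ; owners = [] ; unique = [] ; served = λ _ _ ()
    ; single = λ v → ≤-trans (≤-reflexive (cong (hit ⁅ v ⁆ rest +_) (+-identityʳ _))) (single v)
    ; capped = λ () ; count = λ _ → count′ }
    where
    open Chopped (chop t 1≤t ∣ X ∩ A ∣ (X ∩ A) ≤-refl)
    instance
      τ≢0 : NonZero τ
      τ≢0 = >-nonZero (≤-trans 1≤t t≤τ)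
    g = length blocks
    z = ∣ Z ∩ A ∣
    cover : ∀ v → v ∈ V' ∩ A → v ∈ X ∩ A ⊎ v ∈ Z ∩ A
    cover v v∈ with v ∈? O
    ... | yes v∈O = inj₂ (∈-∩ (∈-∩ (∈-∩ˡ V' A v∈) v∈O) (∈-∩ʳ V' A v∈))
    ... | no v∉O = inj₁ (∈-∩ (x∈p∧x∉q⇒x∈p─q (∈-∩ˡ V' A v∈) v∉O) (∈-∩ʳ V' A v∈))
    count′ : ∣ V' ∩ A ∣ ≤ τ * (g + 0 + z) + ∣ rest ∣
    count′ = begin
      ∣ V' ∩ A ∣                        ≤⟨ cover-card cover ⟩
      ∣ X ∩ A ∣ + z                     ≤⟨ +-mono-≤ size (m≤n*m z τ) ⟩
      t * g + ∣ rest ∣ + τ * z          ≤⟨ +-monoˡ-≤ (τ * z) (+-monoˡ-≤ ∣ rest ∣ (*-monoˡ-≤ g t≤τ)) ⟩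
      τ * g + ∣ rest ∣ + τ * z          ≡⟨ regroup τ g z ∣ rest ∣ ⟩
      τ * (g + 0 + z) + ∣ rest ∣        ∎
      where
      open ≤-Reasoning
      regroup : ∀ τ g z p → τ * g + p + τ * z ≡ τ * (g + 0 + z) + p
      regroup = solve-∀

  -- A member avoiding `A` meets none of the blocks, so only the kept elements of `O` count against
  -- its bound. It is not `T u` for any relevant `u` in `A`, since `T u` contains `u`.
  extend : ∀ {i F A} → Disjoint (L i) A → Grouping F A → Grouping (i ∷ F) A
  extend {i} {F} {A} i#A G = record
    { pending = pending ; free = free ; owned = owned ; pending⊆ = pending⊆ ; pending< = pending<
    ; free-ok = free-ok ; owned-ok = owned-ok
    ; owners = All.map (λ (u∈ , u∈A , Tu∈ , q⊆) → u∈ , u∈A , there Tu∈ , q⊆) owners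
    ; unique = unique ; served = served′ ; single = single ; capped = capped′
    ; count = λ { (inj₁ roomy) → count (inj₁ roomy) ; (inj₂ roomy) → count (inj₂ (roomy ∘ there)) } }
    where
    open Grouping G
    served′ : ∀ {u} → u ∈ O ─ V' → u ∈ A → T u ∈ₗ i ∷ F → u ∈ₗ map proj₁ owned
    served′ {u} u∈ u∈A (here refl) = contradiction u∈A (i#A u (T-member u u∈))
    served′ u∈ u∈A (there Tu∈) = served u∈ u∈A Tu∈
    capped′ : ∀ {j} → j ∈ₗ i ∷ F → load (L j) pending free owned + ∣ Z ∩ L j ∣ ≤ k j
    capped′ (here refl) rewrite load-outside i#A = Z≤k i
    capped′ (there j∈) = capped j∈

  -- By `sides` each listed member sees only one of the two parts, so uniting the pending sets does
  -- not raise its load.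
  merge : ∀ {F A₁ A₂ A} → A₁ ⊆ A → A₂ ⊆ A → Disjoint A₁ A₂ → (∀ v → v ∈ A → v ∈ A₁ ⊎ v ∈ A₂) →
    (∀ {j} → j ∈ₗ F → Disjoint (L j) A₁ ⊎ Disjoint (L j) A₂) → (Roomy F A → 2 * t ≤ τ) →
    Grouping F A₁ → Grouping F A₂ → Grouping F A
  merge {F} {A₁} {A₂} {A} A₁⊆A A₂⊆A A₁#A₂ cover sides roomy G₁ G₂ = record
    { pending = rest ; free = free ; owned = owned
    ; pending⊆ = pending⊆ ∘ rest⊆ ; pending< = rest<
    ; free-ok = Allₚ.++⁺ (blocks-⊆ pending⊆ blocks-ok)
                  (Allₚ.++⁺ (blocks-⊆ (X∩-mono A₁⊆A) G₁.free-ok) (blocks-⊆ (X∩-mono A₂⊆A) G₂.free-ok))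
    ; owned-ok = subst (Blocks t (X ∩ A)) (sym (map-++ proj₂ G₁.owned G₂.owned))
                  (Allₚ.++⁺ (blocks-⊆ (X∩-mono A₁⊆A) G₁.owned-ok) (blocks-⊆ (X∩-mono A₂⊆A) G₂.owned-ok))
    ; owners = Allₚ.++⁺ (All.map (λ (u∈ , u∈A , rest) → u∈ , A₁⊆A u∈A , rest) G₁.owners)
                        (All.map (λ (u∈ , u∈A , rest) → u∈ , A₂⊆A u∈A , rest) G₂.owners)
    ; unique = subst Unique (sym (map-++ proj₁ G₁.owned G₂.owned)) (AllPairsₚ.++⁺ G₁.unique G₂.unique
        (Allₚ.map⁺ (All.map (λ (_ , u∈A₁ , _) → Allₚ.map⁺ (All.map
          (λ (_ , w∈A₂ , _) u≡w → A₁#A₂ _ u∈A₁ (subst (_∈ A₂) (sym u≡w) w∈A₂)) G₂.owners)) G₁.owners)))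
    ; served = served′
    ; single = single′
    ; capped = capped′
    ; count = λ room → count′ (roomy room)
    }
    where
    module G₁ = Grouping G₁
    module G₂ = Grouping G₂
    P = G₁.pending ∪ G₂.pending
    open Settled (settle t τ 1≤t P)
    free = blocks ++ (G₁.free ++ G₂.free)
    owned = G₁.owned ++ G₂.owned
    X∩-mono : ∀ {B} → B ⊆ A → X ∩ B ⊆ X ∩ A
    X∩-mono {B} B⊆A v∈ = ∈-∩ (∈-∩ˡ X B v∈) (B⊆A (∈-∩ʳ X B v∈))
    pending⊆ : P ⊆ X ∩ A
    pending⊆ v∈ with x∈p∪q⁻ G₁.pending G₂.pending v∈
    ... | inj₁ v∈₁ = X∩-mono A₁⊆A (G₁.pending⊆ v∈₁)
    ... | inj₂ v∈₂ = X∩-mono A₂⊆A (G₂.pending⊆ v∈₂)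
    served′ : ∀ {u} → u ∈ O ─ V' → u ∈ A → T u ∈ₗ F → u ∈ₗ map proj₁ owned
    served′ {u} u∈ u∈A Tu∈ = subst (u ∈ₗ_) (sym (map-++ proj₁ G₁.owned G₂.owned)) (side (cover u u∈A))
      where
      side : u ∈ A₁ ⊎ u ∈ A₂ → u ∈ₗ map proj₁ G₁.owned ++ map proj₁ G₂.owned
      side (inj₁ u∈₁) = ∈-++⁺ˡ (G₁.served u∈ u∈₁ Tu∈)
      side (inj₂ u∈₂) = ∈-++⁺ʳ (map proj₁ G₁.owned) (G₂.served u∈ u∈₂ Tu∈)
    w₁ w₂ : Subset n → ℕ
    w₁ p = meets p G₁.free + meets p (map proj₂ G₁.owned)
    w₂ p = meets p G₂.free + meets p (map proj₂ G₂.owned)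
    load-merge : ∀ p → load p rest free owned ≤ hit p P + (w₁ p + w₂ p)
    load-merge p rewrite meets-++ p blocks (G₁.free ++ G₂.free) | meets-++ p G₁.free G₂.free
                       | map-++ proj₂ G₁.owned G₂.owned | meets-++ p (map proj₂ G₁.owned) (map proj₂ G₂.owned) =
      ≤-trans (≤-reflexive (regroup (hit p rest) (meets p blocks) (meets p G₁.free) (meets p G₂.free)
                                  (meets p (map proj₂ G₁.owned)) (meets p (map proj₂ G₂.owned))))
              (+-monoˡ-≤ (w₁ p + w₂ p) (lighter p))
      where
      regroup : ∀ h m a b c d → h + ((m + (a + b)) + (c + d)) ≡ (h + m) + ((a + c) + (b + d))
      regroup = solve-∀
    load-left : ∀ p → Disjoint p A₂ → load p rest free owned ≤ load p G₁.pending G₁.free G₁.owned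
    load-left p p#A₂ = ≤-trans (load-merge p) (+-mono-≤ (hit-mono {p = p} only₁)
      (≤-reflexive (trans (cong (w₁ p +_) (m+n≡0⇒n≡0 (hit p G₂.pending) (G₂.load-outside p#A₂))) (+-identityʳ _))))
      where
      only₁ : ∀ v → v ∈ p → v ∈ P → v ∈ G₁.pending
      only₁ v v∈p v∈P with x∈p∪q⁻ G₁.pending G₂.pending v∈P
      ... | inj₁ v∈₁ = v∈₁
      ... | inj₂ v∈₂ = contradiction (∈-∩ʳ X A₂ (G₂.pending⊆ v∈₂)) (p#A₂ v v∈p)
    load-right : ∀ p → Disjoint p A₁ → load p rest free owned ≤ load p G₂.pending G₂.free G₂.owned
    load-right p p#A₁ = ≤-trans (load-merge p) (+-mono-≤ (hit-mono {p = p} only₂)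
      (≤-reflexive (cong (_+ w₂ p) (m+n≡0⇒n≡0 (hit p G₁.pending) (G₁.load-outside p#A₁)))))
      where
      only₂ : ∀ v → v ∈ p → v ∈ P → v ∈ G₂.pending
      only₂ v v∈p v∈P with x∈p∪q⁻ G₁.pending G₂.pending v∈P
      ... | inj₁ v∈₁ = contradiction (∈-∩ʳ X A₁ (G₁.pending⊆ v∈₁)) (p#A₁ v v∈p)
      ... | inj₂ v∈₂ = v∈₂
    single′ : ∀ v → load ⁅ v ⁆ rest free owned ≤ 1
    single′ v with v ∈? A₁
    ... | yes v∈A₁ = ≤-trans (load-left ⁅ v ⁆ λ w w∈ → A₁#A₂ w (subst (_∈ A₁) (sym (x∈⁅y⁆⇒x≡y v w∈)) v∈A₁)) (G₁.single v)
    ... | no v∉A₁ = ≤-trans (load-right ⁅ v ⁆ λ w w∈ → v∉A₁ ∘ subst (_∈ A₁) (x∈⁅y⁆⇒x≡y v w∈)) (G₂.single v)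
    capped′ : ∀ {j} → j ∈ₗ F → load (L j) rest free owned + ∣ Z ∩ L j ∣ ≤ k j
    capped′ {j} j∈ with sides j∈
    ... | inj₁ j#A₁ = ≤-trans (+-monoˡ-≤ _ (load-right (L j) j#A₁)) (G₂.capped j∈)
    ... | inj₂ j#A₂ = ≤-trans (+-monoˡ-≤ _ (load-left (L j) j#A₂)) (G₁.capped j∈)
    ∩-split : (S : Subset n) → ∀ v → v ∈ S ∩ A → v ∈ S ∩ A₁ ⊎ v ∈ S ∩ A₂
    ∩-split S v v∈ with cover v (∈-∩ʳ S A v∈)
    ... | inj₁ v∈₁ = inj₁ (∈-∩ (∈-∩ˡ S A v∈) v∈₁)
    ... | inj₂ v∈₂ = inj₂ (∈-∩ (∈-∩ˡ S A v∈) v∈₂)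
    count′ : 2 * t ≤ τ → ∣ V' ∩ A ∣ ≤ τ * (length free + length owned + ∣ Z ∩ A ∣) + ∣ rest ∣
    count′ 2t≤τ = begin
      ∣ V' ∩ A ∣
        ≤⟨ cover-card (∩-split V') ⟩
      ∣ V' ∩ A₁ ∣ + ∣ V' ∩ A₂ ∣
        ≤⟨ +-mono-≤ (G₁.count (inj₁ 2t≤τ)) (G₂.count (inj₁ 2t≤τ)) ⟩
      (τ * (f₁ + o₁ + z₁) + p₁) + (τ * (f₂ + o₂ + z₂) + p₂)
        ≡⟨ regroup₁ τ f₁ o₁ z₁ p₁ f₂ o₂ z₂ p₂ ⟩
      τ * (f₁ + f₂ + (o₁ + o₂) + (z₁ + z₂)) + (p₁ + p₂)
        ≤⟨ +-mono-≤ (*-monoʳ-≤ τ (+-monoʳ-≤ (f₁ + f₂ + (o₁ + o₂)) z-split)) (≤-trans pending-split (size P≤τ)) ⟩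
      τ * (f₁ + f₂ + (o₁ + o₂) + z) + (τ * length blocks + ∣ rest ∣)
        ≡⟨ regroup₂ τ f₁ f₂ (o₁ + o₂) z (length blocks) ∣ rest ∣ ⟩
      τ * (length blocks + (f₁ + f₂) + (o₁ + o₂) + z) + ∣ rest ∣
        ≡⟨ cong₂ (λ f o → τ * (f + o + z) + ∣ rest ∣)
             (sym (trans (length-++ blocks) (cong (length blocks +_) (length-++ G₁.free)))) (sym (length-++ G₁.owned)) ⟩
      τ * (length free + length owned + z) + ∣ rest ∣ ∎
      where
      open ≤-Reasoning
      f₁ = length G₁.free
      f₂ = length G₂.free
      o₁ = length G₁.owned
      o₂ = length G₂.owned
      z₁ = ∣ Z ∩ A₁ ∣
      z₂ = ∣ Z ∩ A₂ ∣
      z = ∣ Z ∩ A ∣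
      p₁ = ∣ G₁.pending ∣
      p₂ = ∣ G₂.pending ∣
      regroup₁ : ∀ τ f₁ o₁ z₁ p₁ f₂ o₂ z₂ p₂ → (τ * (f₁ + o₁ + z₁) + p₁) + (τ * (f₂ + o₂ + z₂) + p₂)
        ≡ τ * (f₁ + f₂ + (o₁ + o₂) + (z₁ + z₂)) + (p₁ + p₂)
      regroup₁ = solve-∀
      regroup₂ : ∀ τ f₁ f₂ o z b p → τ * (f₁ + f₂ + o + z) + (τ * b + p) ≡ τ * (b + (f₁ + f₂) + o + z) + p
      regroup₂ = solve-∀
      z-split : z₁ + z₂ ≤ z
      z-split = packing-card
        (λ v∈ → ∈-∩ (∈-∩ˡ Z A₁ v∈) (A₁⊆A (∈-∩ʳ Z A₁ v∈))) (λ v∈ → ∈-∩ (∈-∩ˡ Z A₂ v∈) (A₂⊆A (∈-∩ʳ Z A₂ v∈)))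
        (λ v v∈ v∈′ → A₁#A₂ v (∈-∩ʳ Z A₁ v∈) (∈-∩ʳ Z A₂ v∈′))
      pending-split : p₁ + p₂ ≤ ∣ P ∣
      pending-split = packing-card (p⊆p∪q G₂.pending) (q⊆p∪q G₁.pending G₂.pending)
        (λ v v∈ v∈′ → A₁#A₂ v (∈-∩ʳ X A₁ (G₁.pending⊆ v∈)) (∈-∩ʳ X A₂ (G₂.pending⊆ v∈′)))
      P≤τ : ∣ P ∣ ≤ τ
      P≤τ = ≤-trans (cover-card λ v → x∈p∪q⁻ G₁.pending G₂.pending)
        (≤-trans (+-mono-≤ (<⇒≤ G₁.pending<) (<⇒≤ G₂.pending<)) (≤-trans (≤-reflexive (cong (t +_) (sym (+-identityʳ t)))) 2t≤τ))

  -- In a member with room left nobody waits for a block; in a full one, the waiting elements of O ─ V'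
  -- take free blocks, and surplus free blocks and pending elements are wasted.
  close : ∀ {i F} → All (Nest i) F → Grouping F (L i) → Grouping (i ∷ F) (L i)
  close {i} {F} nest G = result (k i ≤? g + z)
    where
    open Grouping G
    z = ∣ Z ∩ L i ∣
    g = length free + length owned
    roomy : Roomy F (L i)
    roomy = map₂ (λ disjoint j∈ → disjoint _ i (proj₁ (All.lookup nest j∈) ∘ sym)) separated
    owners′ : All (Owner (i ∷ F) (L i)) owned
    owners′ = All.map (λ (u∈ , u∈i , Tu∈ , q⊆) → u∈ , u∈i , there Tu∈ , q⊆) owners
    result : Dec (k i ≤ g + z) → Grouping (i ∷ F) (L i)
    result (no k≰) = record
      { pending = pending ; free = free ; owned = owned ; pending⊆ = pending⊆ ; pending< = pending<
      ; free-ok = free-ok ; owned-ok = owned-ok ; owners = owners′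
      ; unique = unique ; served = served′ ; single = single ; capped = capped′ ; count = λ _ → count roomy }
      where
      -- With fewer than `τ` elements pending, the count stays below one more multiple of `τ`, hence
      -- below `τ * k i`.
      not-tight : ¬ τ * k i ≤ ∣ V' ∩ L i ∣
      not-tight tight = <⇒≱ (begin-strict
        ∣ V' ∩ L i ∣                ≤⟨ count roomy ⟩
        τ * (g + z) + ∣ pending ∣   <⟨ +-monoʳ-< (τ * (g + z)) (<-≤-trans pending< t≤τ) ⟩
        τ * (g + z) + τ             ≡⟨ trans (+-comm _ τ) (sym (*-suc τ (g + z))) ⟩
        τ * suc (g + z)             ≤⟨ *-monoʳ-≤ τ (≰⇒> k≰) ⟩
        τ * k i                     ∎) tight
        where open ≤-Reasoning
      served′ : ∀ {u} → u ∈ O ─ V' → u ∈ L i → T u ∈ₗ i ∷ F → u ∈ₗ map proj₁ owned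
      served′ {u} u∈ _ (here refl) = contradiction (T-tight u u∈) not-tight
      served′ u∈ u∈i (there Tu∈) = served u∈ u∈i Tu∈
      capped′ : ∀ {j} → j ∈ₗ i ∷ F → load (L j) pending free owned + ∣ Z ∩ L j ∣ ≤ k j
      -- The pending set adds at most one to the load, and the spare unit of capacity absorbs it.
      capped′ (here refl) = ≤-trans (+-monoˡ-≤ z (load≤ (L i) pending free owned)) (≰⇒> k≰)
      capped′ (there j∈) = capped j∈
    result (yes k≤) = record
      { pending = ⊥ ; free = free′ ; owned = owned′ ; pending⊆ = ⊥⊆
      ; pending< = ≤-trans (s≤s (≤-reflexive (∣⊥∣≡0 n))) 1≤t
      ; free-ok = Allₚ.take⁺ c (Allₚ.drop⁺ d free-ok)
      ; owned-ok = subst (Blocks t (X ∩ L i)) (sym (map-++ proj₂ new owned))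
          (Allₚ.++⁺ (Allₚ.map⁺ (All.map proj₂ new-ok)) owned-ok)
      ; owners = Allₚ.++⁺ (All.map new-owner new-ok) owners′
      ; unique = subst Unique (sym owners≡) unique′
      ; served = served′
      ; single = λ v → ≤-trans (lighter ⁅ v ⁆) (single v)
      ; capped = capped′
      ; count = λ _ → count′ }
      where
      waiting? : ∀ u → Dec (u ∈ O ─ V' × T u ≡ i)
      waiting? u = u ∈? (O ─ V') ×-dec T u ≟ i
      waiting = filter waiting? (allFin n)
      waiting-ok : All (λ u → u ∈ O ─ V' × T u ≡ i) waiting
      waiting-ok = Allₚ.all-filter waiting? (allFin n)
      d = length waiting
      o = length owned
      f = length free
      -- Waiting elements have `T u ≡ i`, while the members of earlier owners lie in `F` and differ
      -- from `i`.
      unique′ : Unique (waiting ++ map proj₁ owned)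
      unique′ = AllPairsₚ.++⁺ (AllPairsₚ.filter⁺ waiting? (allFin⁺ n)) unique
        (All.map (λ (_ , Tu≡i) → Allₚ.map⁺ (All.map (λ (_ , _ , Tw∈ , _) u≡w →
          proj₁ (All.lookup nest Tw∈) (trans (sym Tu≡i) (cong T u≡w))) owners)) waiting-ok)
      -- Waiting elements, earlier owners and kept elements are distinct members of `O ∩ L i`.
      fits : d + o + z ≤ k i
      fits = begin
        d + o + z                                 ≡⟨ cong (λ l → d + l + z) (sym (length-map proj₁ owned)) ⟩
        d + length (map proj₁ owned) + z          ≡⟨ cong (_+ z) (sym (length-++ waiting)) ⟩
        length (waiting ++ map proj₁ owned) + z   ≤⟨ +-monoˡ-≤ z (unique-length ((O ─ V') ∩ L i) unique′ members) ⟩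
        ∣ (O ─ V') ∩ L i ∣ + z                    ≤⟨ packing-card
          (∩-monoˡ-⊆ (L i) (p─q⊆p O V')) (∩-monoˡ-⊆ (L i) (p∩q⊆q V' O))
          (λ v v∈ v∈′ → ∈-─ʳ O V' (∈-∩ˡ (O ─ V') (L i) v∈) (∈-∩ˡ V' O (∈-∩ˡ Z (L i) v∈′))) ⟩
        ∣ O ∩ L i ∣                               ≤⟨ O-indep i ⟩
        k i                                       ∎
        where
        open ≤-Reasoning
        members : All (_∈ (O ─ V') ∩ L i) (waiting ++ map proj₁ owned)
        members = Allₚ.++⁺
          (All.map (λ { {u} (u∈ , refl) → ∈-∩ u∈ (T-member u u∈) }) waiting-ok)
          (Allₚ.map⁺ (All.map (λ (u∈ , u∈i , _) → ∈-∩ u∈ u∈i) owners))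
      enough : d + o + z ≤ f + o + z
      enough = ≤-trans fits k≤
      d≤f : d ≤ f
      d≤f = +-cancelʳ-≤ o d f (+-cancelʳ-≤ z (d + o) (f + o) enough)
      new = zip waiting free
      new-ok : All (λ (u , q) → (u ∈ O ─ V' × T u ≡ i) × (q ⊆ X ∩ L i × ∣ q ∣ ≡ t)) new
      new-ok = all-zip waiting-ok free-ok
      new-owner : ∀ {uq : Fin n × Subset n} →
        (proj₁ uq ∈ O ─ V' × T (proj₁ uq) ≡ i) × (proj₂ uq ⊆ X ∩ L i × ∣ proj₂ uq ∣ ≡ t) →
        Owner (i ∷ F) (L i) uq
      new-owner {u , q} ((u∈ , refl) , q⊆ , _) = u∈ , T-member u u∈ , here refl , λ _ v∈ → ∈-∩ʳ X (L i) (q⊆ v∈)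
      owned′ = new ++ owned
      owners≡ : map proj₁ owned′ ≡ waiting ++ map proj₁ owned
      owners≡ = trans (map-++ proj₁ new owned) (cong (_++ map proj₁ owned) (zip-proj₁ waiting free d≤f))
      -- Just enough free blocks survive to bring the total to exactly `k i`. The cap then holds,
      -- and `V'-bounded` alone gives the count, whatever has been discarded.
      c = k i ∸ (d + o + z)
      free′ = take c (drop d free)
      length-free′ : length free′ ≡ c
      length-free′ = trans (length-take c (drop d free)) (m≤n⇒m⊓n≡m (begin
        c                       ≤⟨ m≤n+o⇒m∸n≤o (k i) (d + o + z) k≤′ ⟩
        f ∸ d                   ≡⟨ sym (length-drop d free) ⟩
        length (drop d free)    ∎))
        where
        open ≤-Reasoning
        regroup : ∀ a b o z → a + b + o + z ≡ a + o + z + b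
        regroup = solve-∀
        k≤′ : k i ≤ d + o + z + (f ∸ d)
        k≤′ = ≤-trans k≤ (≤-reflexive (trans (cong (λ x → x + o + z) (sym (m+[n∸m]≡n d≤f))) (regroup d (f ∸ d) o z)))
      length-owned′ : length owned′ ≡ d + o
      length-owned′ = begin
        length owned′                           ≡⟨ sym (length-map proj₁ owned′) ⟩
        length (map proj₁ owned′)               ≡⟨ cong length owners≡ ⟩
        length (waiting ++ map proj₁ owned)     ≡⟨ length-++ waiting ⟩
        d + length (map proj₁ owned)            ≡⟨ cong (d +_) (length-map proj₁ owned) ⟩
        d + o                                   ∎
        where open ≡-Reasoning
      full : length free′ + length owned′ + z ≡ k i
      full = trans (cong₂ (λ a b → a + b + z) length-free′ length-owned′)
        (trans (+-assoc c (d + o) z) (m∸n+n≡m fits))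
      served′ : ∀ {u} → u ∈ O ─ V' → u ∈ L i → T u ∈ₗ i ∷ F → u ∈ₗ map proj₁ owned′
      served′ {u} u∈ u∈i Tu∈ = subst (u ∈ₗ_) (sym owners≡) (side Tu∈)
        where
        side : T u ∈ₗ i ∷ F → u ∈ₗ waiting ++ map proj₁ owned
        side (here Tu≡i) = ∈-++⁺ˡ (∈-filter⁺ waiting? (∈-allFin u) (u∈ , Tu≡i))
        side (there Tu∈F) = ∈-++⁺ʳ waiting (served u∈ u∈i Tu∈F)
      hit-⊥ : ∀ p → hit p ⊥ ≡ 0
      hit-⊥ p = hit-disjoint {p = p} (λ _ _ → ∉⊥)
      lighter : ∀ p → load p ⊥ free′ owned′ ≤ load p pending free owned
      lighter p rewrite hit-⊥ p | map-++ proj₂ new owned | meets-++ p (map proj₂ new) (map proj₂ owned) = begin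
        meets p free′ + (meets p (map proj₂ new) + w)           ≤⟨ +-monoˡ-≤ _ (meets-take p c (drop d free)) ⟩
        meets p (drop d free) + (meets p (map proj₂ new) + w)   ≡⟨ regroup (meets p (drop d free)) (meets p (map proj₂ new)) w ⟩
        (meets p (map proj₂ new) + meets p (drop d free)) + w   ≤⟨ +-monoˡ-≤ w (meets-zip p waiting free) ⟩
        meets p free + w                                        ≤⟨ m≤n+m _ (hit p pending) ⟩
        hit p pending + (meets p free + w)                      ∎
        where
        open ≤-Reasoning
        w = meets p (map proj₂ owned)
        regroup : ∀ a b c → a + (b + c) ≡ (b + a) + c
        regroup = solve-∀
      capped′ : ∀ {j} → j ∈ₗ i ∷ F → load (L j) ⊥ free′ owned′ + ∣ Z ∩ L j ∣ ≤ k j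
      capped′ (there j∈) = ≤-trans (+-monoˡ-≤ _ (lighter _)) (capped j∈)
      capped′ (here refl) rewrite hit-⊥ (L i) = ≤-trans (+-monoˡ-≤ z (+-mono-≤ (meets≤length (L i) free′)
        (≤-trans (meets≤length (L i) (map proj₂ owned′)) (≤-reflexive (length-map proj₂ owned′))))) (≤-reflexive full)
      count′ : ∣ V' ∩ L i ∣ ≤ τ * (length free′ + length owned′ + z) + ∣ ⊥ {n} ∣
      count′ = ≤-trans (V'-bounded i) (≤-trans (≤-reflexive (cong (τ *_) (sym full))) (m≤m+n _ _))

  -- The same splitting of the region as in `layout`: the first member inside it is grouped and
  -- closed by itself, then merged with the grouping of the remainder.
  group : (F : List (Fin r)) (A : Subset n) → AllPairs Nest F → Compatible F A → Grouping F A
  group [] A _ _ = group-leaf A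
  group (i ∷ F) A (nest ∷ nests) (position ∷ compatible) with position | nonempty? (L i)
  ... | inj₂ i#A | _ = extend i#A (group F A nests compatible)
  -- An empty member is treated as lying outside, because refuting the second alternative of `Roomy`
  -- below takes an element of `L i`.
  ... | inj₁ _ | no empty = extend (λ v v∈i _ → empty (v , v∈i)) (group F A nests compatible)
  ... | inj₁ i⊆A | yes (v , v∈i) = merge i⊆A (p─q⊆p A (L i)) (λ w w∈i w∈ → ∈-─ʳ A (L i) w∈ w∈i) cover sides roomy
        (close nest (group F (L i) nests (compatible-member nest)))
        (extend (λ w w∈i w∈ → ∈-─ʳ A (L i) w∈ w∈i) (group F (A ─ L i) nests (compatible-─ nest compatible)))
    where
    cover : ∀ w → w ∈ A → w ∈ L i ⊎ w ∈ A ─ L i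
    cover w w∈A with w ∈? L i
    ... | yes w∈i = inj₁ w∈i
    ... | no w∉i = inj₂ (x∈p∧x∉q⇒x∈p─q w∈A w∉i)
    sides : ∀ {j} → j ∈ₗ i ∷ F → Disjoint (L j) (L i) ⊎ Disjoint (L j) (A ─ L i)
    sides (here refl) = inj₂ λ w w∈i w∈ → ∈-─ʳ A (L i) w∈ w∈i
    sides (there j∈) with All.lookup nest j∈
    ... | _ , inj₁ j⊆i = inj₂ λ w w∈j w∈ → ∈-─ʳ A (L i) w∈ (j⊆i w∈j)
    ... | _ , inj₂ j#i = inj₁ j#i
    roomy : Roomy (i ∷ F) A → 2 * t ≤ τ
    roomy (inj₁ 2t≤τ) = 2t≤τ
    roomy (inj₂ disjoint) = contradiction (i⊆A v∈i) (disjoint (here refl) v v∈i)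

-- Robustness in laminar and partition matroids

laminar-robust : {n r : ℕ} (L : Fin r → Subset n) (k : Fin r → ℕ) → Laminar L →
  {ω : Fin n → ℚ} {t τ : ℕ} {V' : Subset n} → 1 ≤ t → t ≤ τ →
  2 * t ≤ τ ⊎ (∀ i j → i ≢ j → Disjoint (L i) (L j)) →
  UnionIndep (LaminarIndep L k) τ V' →
  (∀ u → u ∉ V' → Rejected (UnionIndep (LaminarIndep L k) τ) ω V' u) →
  Robust (LaminarIndep L k) ω t V'
laminar-robust {n} {r} L k laminar {ω} {t} {τ} {V'} 1≤t t≤τ separated V'-indep rejected =
  robust laminar-largest replacements
  where
  open LaminarFamily L
  open LaminarMatroid L k laminar
  open Enumeration (descending laminar)
  V'-bounded : ∀ i → ∣ V' ∩ L i ∣ ≤ τ * k i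
  V'-bounded = laminar-union⁻ {τ} {V'} V'-indep
  Blocks-entry : Fin n → Fin r → Set
  Blocks-entry u i = u ∈ L i × τ * k i ≤ ∣ V' ∩ L i ∣ × (∀ v → v ∈ V' → v ∈ L i → ω u ≤ℚ ω v)
  blocker : ∀ u → u ∉ V' → ∃ (Blocks-entry u)
  blocker u u∉V' with rejected u u∉V'
  ... | S , S⊆V' , ¬indep , S≥
    with tight-member {S} {u} (λ i → τ * k i)
           (λ i → ≤-trans (p⊆q⇒∣p∣≤∣q∣ (∩-monoˡ-⊆ (L i) S⊆V')) (V'-bounded i))
           (¬indep ∘ laminar-union⁺ τ (≤-trans 1≤t t≤τ) (S ∪ ⁅ u ⁆))
  ...   | i , u∈i , tight = i , u∈i , ≤-trans tight (p⊆q⇒∣p∣≤∣q∣ S∩i⊆)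
      -- `S` already fills `L i` up to the bound on `V'`, so the two agree there: every element of
      -- `V' ∩ L i` was collected before `u` was processed.
      , λ v v∈V' v∈i → S≥ v (∈-∩ˡ S (L i)
          (⊆∧∣q∣≤∣p∣⇒⊇ S∩i⊆ (≤-trans (V'-bounded i) tight) (∈-∩ v∈V' v∈i)))
    where
    S∩i⊆ : S ∩ L i ⊆ V' ∩ L i
    S∩i⊆ = ∩-monoˡ-⊆ (L i) S⊆V'
  replacements : ∀ O → Base (LaminarIndep L k) O → ∃ (Replacements (LaminarIndep L k) ω t V' O)
  replacements O (O-indep , _) with any? (λ u → u ∈? (O ─ V'))
  -- Here nothing is replaced and `C` lies in `O`. The case is separate because the other one takes
  -- a default member from some element of `O ─ V'`.
  ... | no none = (λ _ → ⊥) , (λ u u∈ → contradiction (u , u∈) none)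
      , (λ u _ u∈ _ _ → contradiction (u , u∈) none)
      , λ f _ C C≈ i → ≤-trans (p⊆q⇒∣p∣≤∣q∣ (∩-monoˡ-⊆ (L i) (C⊆O f C C≈))) (O-indep i)
    where
    C⊆O : ∀ f C → Exchange V' O f C → C ⊆ O
    C⊆O f C C≈ {v} v∈C with Equivalence.to (C≈ v) v∈C
    ... | inj₁ v∈ = ∈-∩ʳ V' O v∈
    ... | inj₂ (u , u∈ , _) = contradiction (u , u∈) none
  ... | yes (u₀ , u₀∈) = U , good , disj , indep
    where
    -- T needs some value on V'; it is never used.
    target : ∀ u → Dec (u ∈ V') → Fin r
    target u (yes _) = proj₁ (blocker u₀ (∈-─ʳ O V' u₀∈))
    target u (no u∉V') = proj₁ (blocker u u∉V')
    T : Fin n → Fin r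
    T u = target u (u ∈? V')
    T-blocks : ∀ u → u ∈ O ─ V' → Blocks-entry u (T u)
    T-blocks u u∈ with u ∈? V'
    ... | yes u∈V' = contradiction u∈V' (∈-─ʳ O V' u∈)
    ... | no u∉V' = proj₂ (blocker u u∉V')
    open Packing L k V' O T t τ 1≤t t≤τ V'-bounded O-indep
      (λ u u∈ → proj₁ (T-blocks u u∈)) (λ u u∈ → proj₁ (proj₂ (T-blocks u u∈))) separated
    open Grouping (group members ⊤ nested (compatible-⊤ members))
    U : Fin n → Subset n
    U = lookupOr⊥ owned
    U-owned : ∀ u → u ∈ O ─ V' → (u , U u) ∈ₗ owned
    U-owned u u∈ = lookupOr⊥-∈ owned (served u∈ ∈⊤ (complete (T u)))
    U-block : ∀ u → u ∈ O ─ V' → U u ⊆ X ∩ ⊤ × ∣ U u ∣ ≡ t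
    U-block u u∈ = All.lookup owned-ok (∈-map⁺ proj₂ (U-owned u u∈))
    U⊆X : ∀ u → u ∈ O ─ V' → U u ⊆ X
    U⊆X u u∈ v∈ = ∈-∩ˡ X ⊤ (proj₁ (U-block u u∈) v∈)
    good : ∀ u → u ∈ O ─ V' → (U u ⊆ V' ─ O) × (∣ U u ∣ ≡ t) × (∀ v → v ∈ U u → ω u ≤ℚ ω v)
    good u u∈ = U⊆X u u∈ , proj₂ (U-block u u∈) , heavier
      where
      heavier : ∀ v → v ∈ U u → ω u ≤ℚ ω v
      heavier v v∈ with All.lookup owners (U-owned u u∈)
      ... | _ , _ , _ , U⊆L = proj₂ (proj₂ (T-blocks u u∈)) v (p─q⊆p V' O (U⊆X u u∈ v∈)) (U⊆L v v∈)
    -- An element common to blocks of two owners would be counted twice, against `single`.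
    same-owner : ∀ {u u' q q' v} → (u , q) ∈ₗ owned → (u' , q') ∈ₗ owned → v ∈ q → v ∈ q' → u ≡ u'
    same-owner {u} {u'} {v = v} q∈ q'∈ v∈q v∈q' with u ≟ u'
    ... | yes u≡u' = u≡u'
    ... | no u≢u' = contradiction (single v) (<⇒≱ (≤-trans (meets≥2 (x∈⁅x⁆ v) v∈q v∈q' u≢u' q∈ q'∈)
            (≤-trans (m≤n+m _ (meets ⁅ v ⁆ free)) (m≤n+m _ (hit ⁅ v ⁆ pending)))))
    disj : ∀ u u' → u ∈ O ─ V' → u' ∈ O ─ V' → u ≢ u' → Disjoint (U u) (U u')
    disj u u' u∈ u'∈ u≢u' v v∈ v∈' = u≢u' (same-owner (U-owned u u∈) (U-owned u' u'∈) v∈ v∈')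
    -- The new elements of `C` form a choice of one element from each owned block, so `capped`
    -- bounds them together with the kept elements in every member.
    indep : ∀ f → (∀ u → u ∈ O ─ V' → f u ∈ U u) → ∀ C → Exchange V' O f C → LaminarIndep L k C
    indep f f∈U C C≈ i = begin
      ∣ C ∩ L i ∣                                   ≤⟨ cover-card cover ⟩
      ∣ (C ─ Z) ∩ L i ∣ + ∣ Z ∩ L i ∣               ≤⟨ +-monoˡ-≤ ∣ Z ∩ L i ∣ (partial-transversal-card (L i) (map proj₂ owned) (C ─ Z) covered one) ⟩
      meets (L i) (map proj₂ owned) + ∣ Z ∩ L i ∣   ≤⟨ +-monoˡ-≤ ∣ Z ∩ L i ∣ (≤-trans (m≤n+m _ (meets (L i) free)) (m≤n+m _ (hit (L i) pending))) ⟩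
      load (L i) pending free owned + ∣ Z ∩ L i ∣   ≤⟨ capped (complete i) ⟩
      k i                                           ∎
      where
      open ≤-Reasoning
      cover : ∀ v → v ∈ C ∩ L i → v ∈ (C ─ Z) ∩ L i ⊎ v ∈ Z ∩ L i
      cover v v∈ with v ∈? Z
      ... | yes v∈Z = inj₂ (∈-∩ v∈Z (∈-∩ʳ C (L i) v∈))
      ... | no v∉Z = inj₁ (∈-∩ (x∈p∧x∉q⇒x∈p─q (∈-∩ˡ C (L i) v∈) v∉Z) (∈-∩ʳ C (L i) v∈))
      new : ∀ {v} → v ∈ C ─ Z → ∃ λ u → u ∈ O ─ V' × f u ≡ v
      new {v} v∈ with Equivalence.to (C≈ v) (p─q⊆p C Z v∈)
      ... | inj₁ v∈Z = contradiction v∈Z (∈-─ʳ C Z v∈)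
      ... | inj₂ from = from
      covered : ∀ {v} → v ∈ C ─ Z → ∃ λ q → q ∈ₗ map proj₂ owned × v ∈ q
      covered v∈ with new v∈
      ... | u , u∈ , refl = U u , ∈-map⁺ proj₂ (U-owned u u∈) , f∈U u u∈
      one : ∀ {q v w} → q ∈ₗ map proj₂ owned → v ∈ C ─ Z → v ∈ q → w ∈ C ─ Z → w ∈ q → v ≡ w
      one q∈ v∈ v∈q w∈ w∈q with ∈-map⁻ proj₂ q∈ | new v∈ | new w∈
      ... | (_ , _) , uq∈ , refl | u , u∈ , refl | u' , u'∈ , refl =
        cong f (trans (same-owner (U-owned u u∈) uq∈ (f∈U u u∈) v∈q)
                      (sym (same-owner (U-owned u' u'∈) uq∈ (f∈U u' u'∈) w∈q)))

preimage-disjoint : (b : Fin n → Fin m) (i j : Fin m) → i ≢ j → Disjoint (preimage b i) (preimage b j)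
preimage-disjoint b i j i≢j v v∈i v∈j = i≢j (trans (sym (∈-preimage⁻ b i v∈i)) (∈-preimage⁻ b j v∈j))

-- `PartitionIndep b k` unfolds to `LaminarIndep (preimage b) k`, which makes the partition case an
-- instance of the laminar one.
preimage-laminar : (b : Fin n → Fin m) → Laminar (preimage b)
preimage-laminar b i j with i ≟ j
... | yes refl = inj₂ (inj₁ id)
... | no i≢j = inj₁ (preimage-disjoint b i j i≢j)

union-⊥ : {I : Subset n → Set} {τ : ℕ} → 1 ≤ τ → I ⊥ → UnionIndep I τ ⊥
union-⊥ {I = I} (s≤s _) I⊥ = (λ _ → zero) , λ i → subst I (sym (∩-zeroˡ (preimage (λ _ → zero) i))) I⊥

laminar-⊥ : {r : ℕ} (L : Fin r → Subset n) (k : Fin r → ℕ) → LaminarIndep L k ⊥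
laminar-⊥ {n} L k i = ≤-trans (∣p∩q∣≤∣p∣ ⊥ (L i)) (≤-trans (≤-reflexive (∣⊥∣≡0 n)) z≤n)

theorem4 : ∀ {n : ℕ} (ω : Fin n → ℚ) → (∀ u → 0ℚ <ℚ ω u) →
    (t τ : ℕ) → 1 ≤ t → 1 ≤ τ →
    (σ : List (Fin n)) → σ ↭ allFin n → Linked (λ a b → ω b ≤ℚ ω a) σ →
    (∀ {r : ℕ} (b : Fin n → Fin r) (k : Fin r → ℕ) → t ≤ τ →
    ∀ (V' : Subset n) → Greedy (UnionIndep (PartitionIndep b k) τ) ⊥ σ V' →
    Robust (PartitionIndep b k) ω t V')
    × (∀ {r : ℕ} (L : Fin r → Subset n) (k : Fin r → ℕ) → Laminar L → 2 * t ≤ τ →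
    ∀ (V' : Subset n) → Greedy (UnionIndep (LaminarIndep L k) τ) ⊥ σ V' →
    Robust (LaminarIndep L k) ω t V')
    × (∀ {m : ℕ} (A : Fin m → Subset n) (k : ℕ) → HasRank (TransversalIndep A) k →
    t + k ∸ 1 ≤ τ →
    ∀ (V' : Subset n) → Greedy (UnionIndep (TransversalIndep A) τ) ⊥ σ V' →
    Robust (TransversalIndep A) ω t V')
theorem4 {n} ω _ t τ 1≤t 1≤τ σ σ↭ sorted =
    (λ b k t≤τ V' greedy → laminar-robust (preimage b) k (preimage-laminar b) 1≤t t≤τ (inj₂ (preimage-disjoint b))
      (greedy-sound (union-⊥ {I = PartitionIndep b k} 1≤τ (laminar-⊥ (preimage b) k)) greedy) (rejected greedy))
  , (λ L k laminar 2t≤τ V' greedy → laminar-robust L k laminar 1≤t (≤-trans (m≤m+n t (t + 0)) 2t≤τ) (inj₁ 2t≤τ)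
      (greedy-sound (union-⊥ {I = LaminarIndep L k} 1≤τ (laminar-⊥ L k)) greedy) (rejected greedy))
  -- The empty set too needs some map into the index set of the family; the matching of the set
  -- witnessing the rank provides one.
  , (λ A k ((S , (φ , _) , _) , rank) t+k∸1≤τ V' greedy → transversal-robust A rank t+k∸1≤τ
      (greedy-sound (union-⊥ {I = TransversalIndep A} 1≤τ (φ , (λ _ _ u∈ → contradiction u∈ ∉⊥) , λ _ u∈ → contradiction u∈ ∉⊥)) greedy)
      (rejected greedy))
  where
  rejected : {P : Subset n → Set} {V' : Subset n} → Greedy P ⊥ σ V' → ∀ u → u ∉ V' → Rejected P ω V' u
  rejected greedy u = greedy-rejected ω greedy (Linked⇒AllPairs (λ b≤a c≤b → ≤ℚ-trans c≤b b≤a) sorted)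
    (λ _ v∈ → contradiction v∈ ∉⊥) (∈-resp-↭ (↭-sym σ↭) (∈-allFin u))
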